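{- Suppose that $\mathbf{C}(\mathcal{X})$ is strongly connected and that its cyclicity $\gamma$ equals the cyclicity of $\mathcal{D}(\mathcal{X})$. Let $k\ge 1$, let $\Gamma(k)=A_1\otimes\cdots\otimes A_k$ with $A_1,\dots,A_k\in\mathcal{Y}$, and denote $u^{*}_{i,\mathcal{N}_c,j}=w^{*}_{i,\mathcal{N}_c}+v^{*}_{\mathcal{N}_c,j}$. If $k$ is greater than or equal to $$\max\left(\max_{i,j\in N}\ \frac{u^{*}_{i,\mathcal{N}_c,j}-\alpha_{i,\mathcal{N}_c}-\beta_{\mathcal{N}_c,j}}{\lambda_*}+2(n-q)+\mathrm{Sch}(\gamma,q),\ \max_{i,j:\ \gamma_{i,j}>\varepsilon}\ \frac{u^{*}_{i,\mathcal{N}_c,j}-\gamma_{i,j}}{\lambda_*}+n-q+1\right),$$ then $\Gamma(k)=CS^{k\,(\mathrm{mod}\,\gamma)}R[\Gamma(k)]$.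
   Context: **Tropical algebra and digraphs.** $\mathbb{R}_{\max}=\mathbb{R}\cup\{ -\infty\}$, $a\oplus b=\max(a,b)$, $a\otimes b=a+b$, $\varepsilon=-\infty$; $(A\otimes B)_{i,j}=\max_l(a_{i,l}+b_{l,j})$; matrix powers are tropical and $A^0=I$ ($0$ on the diagonal, $\varepsilon$ elsewhere). For an $n\times n$ matrix $A$, $\mathcal{D}(A)$ has nodes $1,\dots,n$ and an edge $(i,j)$ of weight $a_{i,j}$ iff $a_{i,j}\ne\varepsilon$. A walk $(i_0,\dots,i_l)$ follows edges, has length $l$ and weight the sum of its edge weights (a single node is a walk of length and weight $0$); a cycle is a walk with $i_0=i_l$, $l\ge1$; a path is a walk with no repeated node. $A$ is irreducible if $\mathcal{D}(A)$ is strongly connected. $\lambda(A)$ is the maximal mean weight (weight/length) of cycles ($\varepsilon$ if there are none). The critical digraph $\mathbf{C}(A)$ consists of all nodes and edges lying on cycles of mean weight $\lambda(A)$. The cyclicity of a strongly connected digraph is the gcd of its cycle lengths. **Standing assumptions.** $\mathcal{X}$ is a nonempty, possibly infinite, set of $n\times n$ matrices over $\mathbb{R}_{\max}$, each irreducible with finite $\lambda$; $\mathcal{Y}=\{A-\lambda(A): A\in\mathcal{X}\}$ ($\lambda(A)$ subtracted from each entry). $A^{\sup}$, $A^{\inf}$ are the entrywise supremum and infimum of the matrices in $\mathcal{Y}$; $A^{\sup}$ has all entries in $\mathbb{R}_{\max}$. All matrices of $\mathcal{X}$ and $A^{\sup}$ have the same digraph edge set, denoted $\mathcal{D}(\mathcal{X})=(N,E)$,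 and the same critical digraph, denoted $\mathbf{C}(\mathcal{X})=(\mathcal{N}_c,\mathcal{E}_c)$. For $(i,j)\in E$, $(A^{\inf})_{i,j}\neq-\infty$. For all $A\in\mathcal{Y}$: $A_{i,j}=(A^{\sup})_{i,j}=0$ for $(i,j)\in\mathcal{E}_c$, and $A_{i,j}\le0$, $(A^{\sup})_{i,j}\le 0$ for $(i,j)\notin\mathcal{E}_c$. $q=|\mathcal{N}_c|$. **CSR.** $S$ is the $n\times n$ matrix with $S_{i,j}=0$ if $(i,j)\in\mathcal{E}_c$ and $\varepsilon$ otherwise; $\gamma$ is the cyclicity of $\mathbf{C}(\mathcal{X})$; $T(S)$ is the least $T$ with $S^{l+\gamma}=S^l$ for all $l\ge T$; $t$ is any integer with $t\gamma\ge T(S)$. With $k\,(\mathrm{mod}\,\gamma)\in\{0,\dots,\gamma-1\}$, $C=\Gamma(k)\otimes S^{(t+1)\gamma-k(\mathrm{mod}\,\gamma)}$, $R=S^{(t+1)\gamma-k(\mathrm{mod}\,\gamma)}\otimes\Gamma(k)$, and $CS^{k(\mathrm{mod}\,\gamma)}R[\Gamma(k)]=C\otimes S^{k(\mathrm{mod}\,\gamma)}\otimes R$. **Trellis.** The trellis digraph $\mathcal{T}(\Gamma(k))$ has nodes $i:l$ ($i\in N$, $0\le l\le k$) and edges $(i:(l-1),\,j:l)$ of weight $(A_l)_{i,j}$ for $(i,j)\in E$, $1\le l\le k$. $w^*_{i,\mathcal{N}_c}$ is the maximal weight of walks on $\mathcal{T}(\Gamma(k))$ from $i:0$ to some $j:m$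 ($0\le m\le k$) with $j\in\mathcal{N}_c$, whose final node is its only visit to $\mathcal{N}_c$. $v^*_{\mathcal{N}_c,j}$ is the maximal weight of walks from some $i:l$ ($0\le l\le k$), $i\in\mathcal{N}_c$, to $j:k$, whose first node is its only visit to $\mathcal{N}_c$. (Maximum over the empty set is $-\infty$.) **Weights on $\mathcal{D}(A^{\sup})$.** $\alpha_{i,\mathcal{N}_c}$: maximal weight of a path on $\mathcal{D}(A^{\sup})$ from $i$ to a node of $\mathcal{N}_c$; $\beta_{\mathcal{N}_c,j}$: maximal weight of a path from a node of $\mathcal{N}_c$ to $j$; $\gamma_{i,j}$: maximal weight of a path on $\mathcal{D}(A^{\sup})$ from $i$ to $j$ avoiding $\mathcal{N}_c$ (for $i=j$: of a cycle through $i$ avoiding $\mathcal{N}_c$), $\varepsilon$ if none exists. $B^{\sup}$ is obtained from $A^{\sup}$ by setting to $\varepsilon$ all entries $(i,j)$ with $i\in\mathcal{N}_c$ or $j\in\mathcal{N}_c$; $\lambda_*$ is the maximum cycle mean of $B^{\sup}$ (it is $<0$). Conventions: if $\lambda_*=\varepsilon$, fractions with denominator $\lambda_*$ are read as $0$ (the limit $\lambda_*\to\varepsilon$); if $\lambda_*$ is finite and the numerator is $-\infty$, the fraction is $+\infty$. **Schwarz's number.** $\mathrm{Wi}(n)=(n-1)^2+1$ for $n\ge1$, $\mathrm{Wi}(0)=0$; $\mathrm{Sch}(\gamma,n)=\gamma\,\mathrm{Wi}(\lfloor n/\gamma\rfloor)+n\,(\mathrm{mod}\,\gamma)$. -}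

module Defs where

open import Level using (Level; 0ℓ; suc; _⊔_)
open import Algebra.Core using (Op₁; Op₂)
open import Algebra.Structures using (IsCommutativeRing)
import Algebra.Construct.NaturalChoice.Max as Max
import Algebra.Definitions.RawMonoid as RawMonoidDefs
open import Data.Bool.Base using (if_then_else_)
open import Data.Fin.Base using (Fin; zero; inject₁; fromℕ) renaming (suc to fsuc)
open import Data.Fin.Properties using () renaming (_≟_ to _≟ᶠ_)
open import Data.Fin.Subset using (Subset; _∈_; _∉_; ∣_∣)
open import Data.Fin.Subset.Properties using (_∈?_)
open import Data.List.Base as List using (List; []; _∷_)
open import Data.List.Membership.Propositional using () renaming (_∈_ to _∈ˡ_)
open import Data.List.Relation.Unary.All using (All)
open import Data.List.Relation.Unary.Unique.Propositional using (Unique)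
open import Data.Nat.Base as ℕ using (ℕ; NonZero)
open import Data.Nat.DivMod using (_%_) renaming (_/_ to _/ℕ_)
open import Data.Nat.Divisibility using (_∣_)
open import Data.Product.Base using (Σ-syntax; ∃; ∃₂; _×_; _,_; proj₁; proj₂)
open import Data.Sum.Base using (_⊎_)
open import Data.Vec.Base as Vec using (Vec; lookup)
import Data.Vec.Functional as Vector
open import Function.Bundles using (_⇔_)
open import Relation.Binary.Bundles using (TotalOrder)
open import Relation.Binary.Construct.Closure.ReflexiveTransitive as Star
  using (Star; _◅_)
import Relation.Binary.Construct.Add.Infimum.Equality as InfimumEquality
import Relation.Binary.Construct.Add.Infimum.NonStrict as InfimumOrder
import Relation.Binary.Construct.Add.Extrema.Equality as ExtremaEquality
import Relation.Binary.Construct.Add.Extrema.NonStrict as ExtremaOrder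
open import Relation.Binary.Core using (Rel)
open import Relation.Binary.Definitions using (Decidable)
open import Relation.Binary.PropositionalEquality.Core using (_≡_; _≢_)
open import Relation.Binary.Structures using (IsDecTotalOrder)
open import Relation.Nullary using (¬_)
open import Relation.Nullary.Decidable.Core using (does)
import Relation.Nullary.Construct.Add.Extrema as Ext
open import Relation.Nullary.Construct.Add.Infimum using (_₋; ⊥₋; [_])
open import Relation.Unary using (Pred; Satisfiable; U)

-- The reals are characterised classically, as a Dedekind-complete
-- ordered field (unique up to isomorphism); that the order is decidable
-- is part of this classical reading.  The inverse is total, with an
-- unspecified value at 0.

record Reals : Set₁ where
  infix  4 _≈_ _≤_
  infixl 6 _+_ _-_
  infixl 7 _*_ _/_
  infix  8 -_
  infix  9 _⁻¹
  field
    Carrier           : Set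
    _≈_ _≤_           : Rel Carrier 0ℓ
    _+_ _*_           : Op₂ Carrier
    -_ _⁻¹            : Op₁ Carrier
    0# 1#             : Carrier
    isCommutativeRing : IsCommutativeRing _≈_ _+_ _*_ -_ 0# 1#
    isDecTotalOrder   : IsDecTotalOrder _≈_ _≤_
    0≉1               : ¬ 0# ≈ 1#
    ⁻¹-inverseʳ       : ∀ x → ¬ x ≈ 0# → x * x ⁻¹ ≈ 1#
    +-monoˡ-≤         : ∀ z {x y} → x ≤ y → x + z ≤ y + z
    *-nonneg          : ∀ {x y} → 0# ≤ x → 0# ≤ y → 0# ≤ x * y
    complete          : (P : Pred Carrier 0ℓ) → Satisfiable P →
                        (∃ λ b → ∀ x → P x → x ≤ b) →
                        ∃ λ s → (∀ x → P x → x ≤ s) ×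
                                (∀ b → (∀ x → P x → x ≤ b) → s ≤ b)

  _-_ _/_ : Op₂ Carrier
  x - y = x + (- y)
  x / y = x * y ⁻¹

  fromNat : ℕ → Carrier
  fromNat m = RawMonoidDefs._×_ (record { _≈_ = _≈_ ; _∙_ = _+_ ; ε = 0# }) m 1#

private
  variable
    ℓ p : Level
    k n : ℕ

-- A digraph is a relation G, and a walk from u to v is an element of
-- Star G u v.

module _ {V : Set} {G : Rel V ℓ} where

  edges : ∀ {u v} → Star G u v → List (V × V)
  edges Star.ε               = []
  edges (_◅_ {i} {j} _ walk) = (i , j) ∷ edges walk

  length : ∀ {u v} → Star G u v → ℕ
  length walk = List.length (edges walk)

  -- `sources` lists all nodes of the walk but the last, `targets` all
  -- nodes but the first (with repetitions).

  sources targets nodes : ∀ {u v} → Star G u v → List V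
  sources walk       = List.map proj₁ (edges walk)
  targets walk       = List.map proj₂ (edges walk)
  nodes {u = u} walk = u ∷ targets walk

  IsCycle : ∀ {v} → Star G v v → Set
  IsCycle c = 1 ℕ.≤ length c

  IsPath : ∀ {u v} → Star G u v → Set
  IsPath walk = Unique (nodes walk)

StronglyConnected : {V : Set} → Pred V p → Rel V ℓ → Set (p ⊔ ℓ)
StronglyConnected N G = ∀ {u v} → N u → N v → Star G u v

IsCyclicity : {V : Set} → Rel V ℓ → ℕ → Set ℓ
IsCyclicity {V = V} G γ = DividesCycles γ × (∀ d → DividesCycles d → d ∣ γ)
  where
  DividesCycles : ℕ → Set _
  DividesCycles d = ∀ {v : V} (c : Star G v v) → IsCycle c → d ∣ length c

Wi : ℕ → ℕ
Wi ℕ.zero    = 0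
Wi (ℕ.suc m) = m ℕ.^ 2 ℕ.+ 1

Sch : (γ : ℕ) .{{_ : NonZero γ}} → ℕ → ℕ
Sch γ m = γ ℕ.* Wi (m /ℕ γ) ℕ.+ m % γ

module Tropical (ℛ : Reals) where

  open Reals ℛ public

  ℝmax ℝ̄ : Set
  ℝmax = Carrier ₋
  ℝ̄    = Carrier Ext.±

  open InfimumEquality _≈_ public using (_≈₋_)
  open InfimumOrder    _≤_ public using (_≤₋_)
  open ExtremaOrder    _≤_ public using (_≤±_)

  private
    isTotalOrder = IsDecTotalOrder.isTotalOrder isDecTotalOrder

  ℝmax-totalOrder ℝ̄-totalOrder : TotalOrder 0ℓ 0ℓ 0ℓ
  ℝmax-totalOrder = record
    { isTotalOrder = InfimumOrder.≤₋-isTotalOrder _≤_ isTotalOrder }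
  ℝ̄-totalOrder = record
    { isTotalOrder = ExtremaOrder.≤±-isTotalOrder _≤_ isTotalOrder }

  infixl 6 _⊕_ _⊖_ _⊔±_ _⊞_
  infixl 7 _⊗_ _÷_ _⟋_

  ε : ℝmax
  ε = ⊥₋

  _⊕_ : Op₂ ℝmax
  _⊕_ = Max._⊔_ ℝmax-totalOrder

  _⊗_ : Op₂ ℝmax
  ⊥₋    ⊗ _     = ⊥₋
  [ _ ] ⊗ ⊥₋    = ⊥₋
  [ x ] ⊗ [ y ] = [ x + y ]

  _⊖_ : ℝmax → Carrier → ℝmax
  x ⊖ y = x ⊗ [ - y ]

  -- Only used for m ≥ 1.
  _÷_ : ℝmax → ℕ → ℝmax
  ⊥₋    ÷ _ = ⊥₋
  [ x ] ÷ m = [ x / fromNat m ]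

  ⨁ : (Fin n → ℝmax) → ℝmax
  ⨁ = Vector.foldr _⊕_ ε

  _⊔±_ : Op₂ ℝ̄
  _⊔±_ = Max._⊔_ ℝ̄-totalOrder

  ⨆ : (Fin n → ℝ̄) → ℝ̄
  ⨆ = Vector.foldr _⊔±_ Ext.⊥±

  -- The fraction a / d for d < 0 or d = ε, in the limiting sense: it is
  -- 0 whenever d = ε, and +∞ when a = -∞ and d is finite.
  _⟋_ : ℝmax → ℝmax → ℝ̄
  _     ⟋ ⊥₋    = Ext.[ 0# ]
  ⊥₋    ⟋ [ _ ] = Ext.⊤±
  [ a ] ⟋ [ d ] = Ext.[ a / d ]

  _⊞_ : ℝ̄ → ℕ → ℝ̄
  Ext.⊥±    ⊞ _ = Ext.⊥±
  Ext.[ x ] ⊞ m = Ext.[ x + fromNat m ]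
  Ext.⊤±    ⊞ _ = Ext.⊤±

  -- Drops from a maximum the terms indexed by values equal to ε.
  whenFinite : ℝmax → (Carrier → ℝ̄) → ℝ̄
  whenFinite ⊥₋    _ = Ext.⊥±
  whenFinite [ x ] f = f x

  IsMaximum : Pred ℝmax ℓ → ℝmax → Set ℓ
  IsMaximum P m =
    (∀ x → P x → x ≤₋ m) × (P m ⊎ ((∀ x → ¬ P x) × m ≡ ε))

  IsSupremum IsInfimum : Pred ℝmax ℓ → ℝmax → Set ℓ
  IsSupremum P s = (∀ x → P x → x ≤₋ s) × (∀ b → (∀ x → P x → x ≤₋ b) → s ≤₋ b)
  IsInfimum  P s = (∀ x → P x → s ≤₋ x) × (∀ b → (∀ x → P x → b ≤₋ x) → b ≤₋ s)

  Matrix : ℕ → Set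
  Matrix n = Fin n → Fin n → ℝmax

  infix  4 _≋_
  infixl 7 _⊠_
  infixr 8 _^ᵐ_

  _≋_ : Rel (Matrix n) 0ℓ
  A ≋ B = ∀ i j → A i j ≈₋ B i j

  I : Matrix n
  I i j = if does (i ≟ᶠ j) then [ 0# ] else ε

  _⊠_ : Op₂ (Matrix n)
  (A ⊠ B) i j = ⨁ λ l → A i l ⊗ B l j

  _^ᵐ_ : Matrix n → ℕ → Matrix n
  A ^ᵐ ℕ.zero  = I
  A ^ᵐ ℕ.suc m = A ⊠ A ^ᵐ m

  prod : Vec (Matrix n) k → Matrix n
  prod = Vec.foldr _ _⊠_ I

  -- The least T with A^(l+γ) = A^l for all l ≥ T.
  IsTransient : Matrix n → ℕ → ℕ → Set
  IsTransient A γ T = PeriodicFrom T × (∀ T′ → PeriodicFrom T′ → T ℕ.≤ T′)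
    where
    PeriodicFrom : ℕ → Set
    PeriodicFrom T = ∀ l → T ℕ.≤ l → A ^ᵐ (l ℕ.+ γ) ≋ A ^ᵐ l

  weight : {V : Set} {G : Rel V ℓ} → (∀ {u v} → G u v → ℝmax) →
           ∀ {u v} → Star G u v → ℝmax
  weight ω Star.ε     = [ 0# ]
  weight ω (e ◅ walk) = ω e ⊗ weight ω walk

  𝒟 : Matrix n → Rel (Fin n) 0ℓ
  𝒟 A i j = A i j ≢ ε

  weightᵐ : (A : Matrix n) {i j : Fin n} → Star (𝒟 A) i j → ℝmax
  weightᵐ A = weight (λ {i} {j} _ → A i j)

  mean : (A : Matrix n) {i j : Fin n} → Star (𝒟 A) i j → ℝmax
  mean A walk = weightᵐ A walk ÷ length walk

  Irreducible : Matrix n → Set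
  Irreducible A = StronglyConnected U (𝒟 A)

  IsMaxCycleMean : Matrix n → ℝmax → Set
  IsMaxCycleMean A = IsMaximum λ x →
    ∃ λ v → Σ[ c ∈ Star (𝒟 A) v v ] IsCycle c × mean A c ≈₋ x

  IsCritical : (A : Matrix n) {v : Fin n} → Star (𝒟 A) v v → Set
  IsCritical A c = IsCycle c × IsMaxCycleMean A (mean A c)

  CriticalNode : Matrix n → Pred (Fin n) 0ℓ
  CriticalNode A i =
    ∃ λ v → Σ[ c ∈ Star (𝒟 A) v v ] IsCritical A c × i ∈ˡ nodes c

  CriticalEdge : Matrix n → Rel (Fin n) 0ℓ
  CriticalEdge A i j =
    ∃ λ v → Σ[ c ∈ Star (𝒟 A) v v ] IsCritical A c × (i , j) ∈ˡ edges c

  Normalised : Pred (Matrix n) p → Pred (Matrix n) p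
  Normalised 𝒳 B = ∃₂ λ A μ →
    𝒳 A × IsMaxCycleMean A [ μ ] × (∀ i j → B i j ≈₋ A i j ⊖ μ)

  EntryOf : Pred (Matrix n) p → Fin n → Fin n → Pred ℝmax p
  EntryOf 𝒴 i j x = ∃ λ A → 𝒴 A × A i j ≈₋ x

  record Setting {n : ℕ} (𝒳 : Pred (Matrix n) p) : Set (suc 0ℓ ⊔ p) where
    𝒴 : Pred (Matrix n) p
    𝒴 = Normalised 𝒳

    field
      nonempty     : Satisfiable 𝒳
      irreducible  : ∀ A → 𝒳 A → Irreducible A
      λ-finite     : ∀ A → 𝒳 A → ∃ λ μ → IsMaxCycleMean A [ μ ]

      Aˢᵘᵖ Aⁱⁿᶠ    : Matrix n
      isSupremum   : ∀ i j → IsSupremum (EntryOf 𝒴 i j) (Aˢᵘᵖ i j)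
      isInfimum    : ∀ i j → IsInfimum  (EntryOf 𝒴 i j) (Aⁱⁿᶠ i j)

      -- The digraph D(𝒳) = (N, E) and the critical digraph
      -- C(𝒳) = (𝓝c, 𝓔c), with N = Fin n.
      E            : Rel (Fin n) 0ℓ
      𝓝c           : Subset n
      𝓔c           : Rel (Fin n) 0ℓ
      _𝓔c?_        : Decidable 𝓔c

      digraph      : ∀ A → 𝒳 A → ∀ i j → E i j ⇔ 𝒟 A i j
      digraphˢᵘᵖ   : ∀ i j → E i j ⇔ 𝒟 Aˢᵘᵖ i j
      critNodes    : ∀ A → 𝒳 A → ∀ i → i ∈ 𝓝c ⇔ CriticalNode A i
      critNodesˢᵘᵖ : ∀ i → i ∈ 𝓝c ⇔ CriticalNode Aˢᵘᵖ i
      critEdges    : ∀ A → 𝒳 A → ∀ i j → 𝓔c i j ⇔ CriticalEdge A i j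
      critEdgesˢᵘᵖ : ∀ i j → 𝓔c i j ⇔ CriticalEdge Aˢᵘᵖ i j

      inf-finite   : ∀ i j → E i j → Aⁱⁿᶠ i j ≢ ε
      critical≈0   : ∀ A → 𝒴 A → ∀ i j → 𝓔c i j → A i j ≈₋ [ 0# ]
      criticalˢᵘᵖ  : ∀ i j → 𝓔c i j → Aˢᵘᵖ i j ≈₋ [ 0# ]
      others≤0     : ∀ A → 𝒴 A → ∀ i j → ¬ 𝓔c i j → A i j ≤₋ [ 0# ]
      othersˢᵘᵖ    : ∀ i j → ¬ 𝓔c i j → Aˢᵘᵖ i j ≤₋ [ 0# ]

    q : ℕ
    q = ∣ 𝓝c ∣

    S : Matrix n
    S i j = if does (i 𝓔c? j) then [ 0# ] else ε

    module _ (γ : ℕ) .{{_ : NonZero γ}} (t k : ℕ) (Γ : Matrix n) where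

      private
        S^[t+1]γ-kmodγ = S ^ᵐ ((t ℕ.+ 1) ℕ.* γ ℕ.∸ k % γ)

      C R CSR : Matrix n
      C   = Γ ⊠ S^[t+1]γ-kmodγ
      R   = S^[t+1]γ-kmodγ ⊠ Γ
      CSR = C ⊠ S ^ᵐ (k % γ) ⊠ R

    module Trellis {k : ℕ} (As : Vec (Matrix n) k) where

      -- (i , l) is the node i:l.
      Node : Set
      Node = Fin n × Fin (ℕ.suc k)

      -- `step l` is an edge from level l to level l + 1, whose weight is
      -- given by the matrix at position l of As, counting from 0.
      data Edge : Rel Node 0ℓ where
        step : ∀ {i j} (l : Fin k) → E i j → Edge (i , inject₁ l) (j , fsuc l)

      ω : ∀ {x y} → Edge x y → ℝmax
      ω (step {i} {j} l _) = lookup As l i j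

      IsW* : Fin n → ℝmax → Set
      IsW* i = IsMaximum λ x →
        ∃₂ λ j m → Σ[ walk ∈ Star Edge (i , zero) (j , m) ]
          j ∈ 𝓝c × All (λ y → proj₁ y ∉ 𝓝c) (sources walk) × weight ω walk ≈₋ x

      IsV* : Fin n → ℝmax → Set
      IsV* j = IsMaximum λ x →
        ∃₂ λ i l → Σ[ walk ∈ Star Edge (i , l) (j , fromℕ k) ]
          i ∈ 𝓝c × All (λ y → proj₁ y ∉ 𝓝c) (targets walk) × weight ω walk ≈₋ x

    IsAlpha : Fin n → ℝmax → Set
    IsAlpha i = IsMaximum λ x →
      ∃ λ j → Σ[ walk ∈ Star (𝒟 Aˢᵘᵖ) i j ]
        j ∈ 𝓝c × IsPath walk × weightᵐ Aˢᵘᵖ walk ≈₋ x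

    IsBeta : Fin n → ℝmax → Set
    IsBeta j = IsMaximum λ x →
      ∃ λ i → Σ[ walk ∈ Star (𝒟 Aˢᵘᵖ) i j ]
        i ∈ 𝓝c × IsPath walk × weightᵐ Aˢᵘᵖ walk ≈₋ x

    IsGamma : Fin n → Fin n → ℝmax → Set
    IsGamma i j = IsMaximum λ x →
      (i ≢ j × Σ[ walk ∈ Star (𝒟 Aˢᵘᵖ) i j ]
         IsPath walk × All (_∉ 𝓝c) (nodes walk) × weightᵐ Aˢᵘᵖ walk ≈₋ x)
      ⊎
      (i ≡ j × ∃ λ v → Σ[ c ∈ Star (𝒟 Aˢᵘᵖ) v v ]
         IsCycle c × i ∈ˡ nodes c ×
         All (_∉ 𝓝c) (nodes c) × weightᵐ Aˢᵘᵖ c ≈₋ x)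

    Bˢᵘᵖ : Matrix n
    Bˢᵘᵖ i j =
      if does (i ∈? 𝓝c) then ε else
      if does (j ∈? 𝓝c) then ε else Aˢᵘᵖ i j

{-# OPTIONS --safe #-}
-- Both Γ = Γ(k) and CSR[Γ] have (i,j) entry u*ᵢⱼ if j lies k cyclic classes
-- after i in D(𝒳), and ε otherwise.  For CSR this holds because an entry of
-- Γ from i to a critical node is at most w*ᵢ, the bound being attained by
-- prolonging an optimal walk along critical edges (of weight 0), and powers of
-- S from T(S) on are full between nodes of the right classes.
--
-- For Γ, a walk through 𝓝c has weight at most u*ᵢⱼ, because all entries are at
-- most 0.  A walk of length k avoiding 𝓝c is a path (or a cycle) together with
-- cycles of B^sup, so its weight is at most γᵢⱼ + (k - (n - q)) λ*, which the
-- second bound compares with u*ᵢⱼ.  Erasing cycles in the same way from optimal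
-- walks for w*ᵢ and v*ⱼ bounds their lengths; by the first bound the gap left
-- between them is at least Sch(γ,q), and it is filled by a critical walk.
--
-- The latter uses Schwarz's theorem.  From any node at most q mod γ steps lead
-- to a cyclic class with at most ⌊q/γ⌋ nodes, or at most γ - 1 steps to a
-- strictly smaller one, and within that class Wielandt's theorem applies to
-- the walks of length γ.
module Submission where

open import Defs
open import Data.Fin.Base using (Fin)
open import Data.Fin.Subset using (_∈_)
open import Data.Nat.Base as ℕ using (ℕ; NonZero; _∸_)
open import Data.Vec.Base using (Vec; lookup)
open import Level using (Level)
open import Relation.Nullary.Construct.Add.Infimum using ([_])
open import Relation.Nullary.Construct.Add.Extrema as Ext using ()
open import Relation.Unary using (Pred)

open import Algebra.Bundles using (CommutativeMonoid; CommutativeRing)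
import Algebra.Construct.NaturalChoice.Max as NaturalMax
import Algebra.Properties.Monoid.Mult as MonoidMult
import Algebra.Properties.Ring as RingProperties
import Algebra.Solver.CommutativeMonoid as CommutativeMonoidSolver
open import Data.Fin.Base as Fin using (toℕ; fromℕ; inject₁)
open import Data.Fin.Properties as Fin using (toℕ-injective; toℕ-inject₁; toℕ-fromℕ; toℕ<n)
open import Data.Fin.Subset using (Subset; _∉_; ∣_∣; inside; outside)
open import Data.Fin.Subset.Properties
  using (_∈?_; ∣∁p∣≡n∸∣p∣; x∉p⇒x∈∁p; x∈p⇒∣p-x∣<∣p∣; x∈p∧x≢y⇒x∈p-y)
open import Data.List.Base as List using (List; []; _∷_)
open import Data.List.Membership.DecPropositional using () renaming (_∈?_ to mem?)
open import Data.List.Membership.Propositional using () renaming (_∈_ to _∈ˡ_)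
open import Data.List.Membership.Propositional.Properties using (∈-map⁺; ∈-map⁻)
import Data.List.Properties as List
open import Data.List.Relation.Unary.All as All using (All; []; _∷_)
open import Data.List.Relation.Unary.All.Properties as All using (¬Any⇒All¬)
open import Data.List.Relation.Unary.AllPairs using ([]; _∷_)
open import Data.List.Relation.Unary.Any using (here; there)
open import Data.List.Relation.Unary.Unique.Propositional using (Unique)
open import Data.Nat.Base using (zero; suc)
open import Data.Nat.DivMod using (_%_; m%n<n; m≡m%n+[m/n]*n) renaming (_/_ to _/ℕ_)
import Data.Nat.Properties as ℕ
open import Data.Nat.Tactic.RingSolver using (solve-∀)
open import Data.Product using (∃; ∃₂; Σ; Σ-syntax; _×_; _,_; proj₁; proj₂)
open import Data.Sum.Base using (_⊎_; inj₁; inj₂)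
open import Data.Vec.Base as Vec using ([]; _∷_; here; there)
open import Function.Bundles using (module Equivalence)
open import Level using (0ℓ)
open import Relation.Binary.Bundles using (DecTotalOrder; TotalOrder)
open import Relation.Binary.Construct.Add.Extrema.NonStrict as ExtremaOrder using ()
open import Relation.Binary.Construct.Add.Infimum.NonStrict using (⊥₋≤_; [_])
open import Relation.Binary.Construct.Add.Point.Equality using (∙≈∙; [_])
open import Relation.Binary.Construct.Closure.ReflexiveTransitive as Star using (Star; _◅_; _◅◅_)
open import Relation.Binary.Core using (Rel)
open import Relation.Binary.Definitions using (DecidableEquality)
open import Relation.Binary.PropositionalEquality as ≡
  using (_≡_; _≢_; refl; sym; trans; cong; subst)
open import Relation.Nullary using (¬_; yes; no; contradiction)
open import Relation.Nullary.Construct.Add.Infimum using (⊥₋)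
open import Relation.Unary using (Decidable)

-- Walks of a prescribed length, and Wielandt's theorem.

module Digraphs where

  open import Data.Fin.Base as Fin using (Fin; toℕ)
  open import Data.Fin.Properties using (pigeonhole; toℕ<n)
  open import Data.Nat.Base
  open import Data.Nat.Properties
  open import Data.Nat.DivMod
  open import Data.Nat.Divisibility
  open import Data.Nat.Induction using (<-rec)
  open import Data.List.Base as List using (List; []; _∷_; filter; allFin)
  open import Data.List.Properties using (length-filter; length-tabulate)
  open import Data.List.Membership.Propositional.Properties
    using (∈-filter⁺; ∈-filter⁻; ∈-allFin; ∈-lookup)
  open import Data.List.Relation.Unary.Any using (index)
  open import Data.List.Relation.Unary.Any.Properties using (lookup-index)
  open ≡ using (subst₂; cong₂)

  module _ {V : Set} where

    -- The length is an index because Wielandt's and Schwarz's theorems assert the existence of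
    -- walks of one exact length.
    data Walk (G : Rel V 0ℓ) : ℕ → Rel V 0ℓ where
      []  : ∀ {i} → Walk G 0 i i
      _∷_ : ∀ {i h j l} → G i h → Walk G l h j → Walk G (suc l) i j

    infixr 5 _∷_ _++_

    private variable
      G : Rel V 0ℓ
      i j h : V
      a b l : ℕ

    _++_ : Walk G a i h → Walk G b h j → Walk G (a + b) i j
    []      ++ w = w
    (e ∷ u) ++ w = e ∷ (u ++ w)

    split : ∀ a → Walk G (a + b) i j → ∃ λ h → Walk G a i h × Walk G b h j
    split zero    w       = _ , [] , w
    split (suc a) (e ∷ w) = let h , u , u′ = split a w in h , e ∷ u , u′

    iterate : ∀ m → Walk G l i i → Walk G (m * l) i i
    iterate zero    w = []
    iterate (suc m) w = w ++ iterate m w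

    vertex : Walk G l i j → ℕ → V
    vertex {i = i} w       zero    = i
    vertex         (_ ∷ w) (suc p) = vertex w p
    -- Default beyond the end of the walk; `repetition` looks only at positions up to the length.
    vertex {i = i} []      (suc p) = i

    -- Unlike in `split`, the node of the cut is named by `vertex`, so that an equality of two
    -- vertices turns the piece between them into a closed walk.
    cut : ∀ a (w : Walk G (a + b) i j) → Walk G a i (vertex w a) ×
          Σ (Walk G b (vertex w a) j) λ w′ → ∀ s → vertex w (a + s) ≡ vertex w′ s
    cut zero    w       = [] , w , λ _ → refl
    cut (suc a) (e ∷ w) = let u , w′ , eq = cut a w in e ∷ u , w′ , eq

  -- The pigeonhole principle is applied to the first `m + 1` vertices only. Hence `p + suc s ≤ m`:
  -- the closed walk is completed within `m` steps, which `lasso` exploits.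
  repetition : ∀ {m l} {G : Rel (Fin m) 0ℓ} {i j} → m ≤ l → Walk G l i j →
    ∃₂ λ x p → ∃₂ λ s r → p + (suc s + r) ≡ l × p + suc s ≤ m ×
      Walk G p i x × Walk G (suc s) x x × Walk G r x j
  repetition {m} {l} {G} {i} {j} m≤l w
    with P , P′ , P<P′ , eq ← pigeonhole (n<1+n m) (λ p → vertex w (toℕ p))
    with s , p+s≡p′ ← m≤n⇒∃[o]m+o≡n P<P′
    with r , p′+r≡l ← m≤n⇒∃[o]m+o≡n (≤-trans (≤-pred (toℕ<n P′)) m≤l)
    with p+s≡p′ ← trans (+-suc (toℕ P) s) p+s≡p′
    = from (toℕ P) s r
        (trans (sym (+-assoc (toℕ P) (suc s) r)) (trans (cong (_+ r) p+s≡p′) p′+r≡l))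
        (subst (_≤ m) (sym p+s≡p′) (≤-pred (toℕ<n P′)))
        w (trans eq (cong (vertex w) (sym p+s≡p′)))
    where
    from : ∀ p s r {l} → p + (suc s + r) ≡ l → p + suc s ≤ m → (w : Walk G l i j) →
           vertex w p ≡ vertex w (p + suc s) →
           ∃₂ λ x p → ∃₂ λ s r → p + (suc s + r) ≡ l × p + suc s ≤ m ×
             Walk G p i x × Walk G (suc s) x x × Walk G r x j
    from p s r refl p+s≤m w eq
      with u , w′ , at ← cut p w
      with c , z , _ ← cut (suc s) w′
      with closed ← trans eq (at (suc s))
      = vertex w p , p , s , r , refl , p+s≤m , u
      , subst (Walk G (suc s) _) (sym closed) c
      , subst (λ x → Walk G r x j) (sym closed) z

  shorten : ∀ {m} {G : Rel (Fin m) 0ℓ} {i j} l → Walk G l i j →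
    ∃ λ l′ → l′ < m × Walk G l′ i j
  shorten {m} {G} {i} {j} = <-rec _ step
    where
    step : ∀ l → (∀ {l₁} → l₁ < l → Walk G l₁ i j → ∃ λ l′ → l′ < m × Walk G l′ i j) →
           Walk G l i j → ∃ λ l′ → l′ < m × Walk G l′ i j
    step l rec w with l <? m
    ... | yes l<m = l , l<m , w
    ... | no  l≮m with repetition (≮⇒≥ l≮m) w
    ... | _ , p , s , r , refl , _ , u , _ , z =
      rec (+-monoʳ-< p (s≤s (m≤n+m r s))) (u ++ z)

  lasso : ∀ {m} {G : Rel (Fin m) 0ℓ} {i} l → Walk G l i i → ¬ m ∣ l →
    ∃₂ λ x d → ∃ λ s → suc s < m × d + suc s ≤ m × Walk G d i x × Walk G (suc s) x x
  lasso {m} {G} {i} = <-rec _ step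
    where
    Lasso = ∃₂ λ x d → ∃ λ s → suc s < m × d + suc s ≤ m × Walk G d i x × Walk G (suc s) x x

    Hamiltonian : ∀ {x} p s r → suc s ≡ m → p + suc s ≤ m → Walk G p i x → Walk G r x i →
      (∀ {l} → l < p + (suc s + r) → Walk G l i i → ¬ m ∣ l → Lasso) →
      ¬ m ∣ p + (suc s + r) → Lasso
    Hamiltonian zero s r refl _ [] w rec m∤l =
      rec (s≤s (m≤n+m r s)) w λ m∣r → m∤l (∣m∣n⇒∣m+n ∣-refl m∣r)
    Hamiltonian (suc p) s r refl p+s≤m _ _ _ _ =
      contradiction (≤-trans (s≤s (m≤n+m (suc s) p)) p+s≤m) 1+n≰n

    step : ∀ l → (∀ {l₁} → l₁ < l → Walk G l₁ i i → ¬ m ∣ l₁ → Lasso) →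
           Walk G l i i → ¬ m ∣ l → Lasso
    step l rec w m∤l with l <? m
    step zero    rec w m∤l | yes l<m = contradiction (m ∣0) m∤l
    step (suc l) rec w m∤l | yes l<m = i , 0 , l , l<m , <⇒≤ l<m , [] , w
    step l rec w m∤l | no l≮m with repetition (≮⇒≥ l≮m) w
    ... | x , p , s , r , refl , p+s≤m , u , c , z with suc s <? m
    ...   | yes s<m = x , p , s , s<m , p+s≤m , u , c
    ...   | no  s≮m = Hamiltonian p s r (≤-antisym (m+n≤o⇒n≤o p p+s≤m) (≮⇒≥ s≮m))
                        p+s≤m u z rec m∤l

  -- `Walk G s` is itself a relation, so it serves as the `s`-th power of the digraph; `flatten` and
  -- `chunk` translate between its walks and those of `G`.
  flatten : ∀ {V : Set} {G : Rel V 0ℓ} {s l i j} → Walk (Walk G s) l i j → Walk G (l * s) i j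
  flatten []      = []
  flatten (c ∷ w) = c ++ flatten w

  chunk : ∀ {V : Set} {G : Rel V 0ℓ} l {s i j} → Walk G (l * s) i j → Walk (Walk G s) l i j
  chunk zero        []  = []
  chunk (suc l) {s} w = let h , u , v = split s w in u ∷ chunk l v

  module _ {V W : Set} {G : Rel V 0ℓ} (e : W → V) where

    pushforward : ∀ {l s t} → Walk (λ s t → G (e s) (e t)) l s t → Walk G l (e s) (e t)
    pushforward []      = []
    pushforward (g ∷ w) = g ∷ pushforward w

    -- Not true for empty walks, as e need not be injective.
    pullback : (∀ {s y} → G (e s) y → ∃ λ t → e t ≡ y) →
               ∀ {l s t} → Walk G (suc l) (e s) (e t) → Walk (λ s t → G (e s) (e t)) (suc l) s t
    pullback closed {zero}  (g ∷ []) = g ∷ []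
    pullback closed {suc l} (g ∷ w) with closed g
    ... | t , refl = g ∷ pullback closed w

  -- Primitivity is given by a threshold `T`. From `i` one reaches in `d` steps a node `x` on a
  -- closed walk of length `c < m`. In the digraph of walks of length `c` the node `x` has a loop,
  -- so every node is reached from it in exactly `m - 1` steps, after padding by that loop. As
  -- `d + c ≤ m`, the total `d + (m - 1) c` is at most `m + (m - 2) (m - 1) = Wi m`.
  wielandt : ∀ {m} {G : Rel (Fin m) 0ℓ} {T} → (∀ l i j → T ≤ l → Walk G l i j) →
             ∀ l i j → Wi m ≤ l → Walk G l i j
  wielandt {suc zero} {T = T} full l Fin.zero Fin.zero _
    with Fin.zero , w , _ ← split l (full (l + T) Fin.zero Fin.zero (m≤n+m T l)) = w
  wielandt {m@(suc (suc k))} {G} {T} full l i j Wi≤l = reach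
    where
    short-lasso : ∃₂ λ x d → ∃ λ s → suc s < m × d + suc s ≤ m × Walk G d i x × Walk G (suc s) x x
    short-lasso with m ∣? T
    ... | no  m∤T = lasso T (full T i i ≤-refl) m∤T
    ... | yes m∣T = lasso (T + 1) (full (T + 1) i i (m≤m+n T 1)) λ m∣T+1 →
      contradiction (∣⇒≤ (∣m+n∣m⇒∣n m∣T+1 m∣T)) λ { (s≤s ()) }

    bound : ∀ d s → suc s < m → d + suc s ≤ m → d + suc k * suc s ≤ Wi m
    bound d s (s≤s s<) d+s≤m = begin
      d + (suc s + k * suc s)   ≡⟨ sym (+-assoc d (suc s) (k * suc s)) ⟩
      d + suc s + k * suc s     ≤⟨ +-mono-≤ d+s≤m (*-monoʳ-≤ k s<) ⟩
      m + k * suc k             ≡⟨ poly k ⟩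
      Wi m                      ∎
      where
      open ≤-Reasoning
      poly : ∀ k → suc (suc k) + k * suc k ≡ suc k * (suc k * 1) + 1
      poly = solve-∀

    reach : Walk G l i j
    reach
      with x , d , s , s<m , d+s≤m , u , c ← short-lasso
      with e , eq ← m≤n⇒∃[o]m+o≡n (≤-trans (bound d s s<m d+s≤m) Wi≤l)
      -- The surplus `e` is spent at the end: `j′` is a node from which `j` is reached in `e` steps.
      with j′ , _ , z ← split T (full (T + e) j j (m≤m+n T e))
      with L , L<m , w ← shorten {G = Walk G (suc s)} T
                           (chunk T (full (T * suc s) x j′ (m≤m*n T (suc s))))
      with f , L+f≡ ← m≤n⇒∃[o]m+o≡n (≤-pred L<m)
      = subst (λ l → Walk G l i j) eq
          ((u ++ subst (λ l → Walk G l x j′) pad (iterate f c ++ flatten w)) ++ z)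
      where
      pad : f * suc s + L * suc s ≡ suc k * suc s
      pad = trans (sym (*-distribʳ-+ (suc s) f L)) (cong (_* suc s) (trans (+-comm f L) L+f≡))

  -- Congruence modulo `γ` and its use for cyclic classes.

  module Congruence (γ : ℕ) where

    infix 4 _~_
    -- Stated with a multiple of `γ` on each side, which avoids subtraction in ℕ.
    record _~_ (a b : ℕ) : Set where
      constructor congruent
      field
        x y : ℕ
        equation : a + x * γ ≡ b + y * γ

    ~-reflexive : ∀ {a b} → a ≡ b → a ~ b
    ~-reflexive refl = congruent 0 0 refl

    ~-sym : ∀ {a b} → a ~ b → b ~ a
    ~-sym (congruent x y eq) = congruent y x (sym eq)

    ~-+ : ∀ {a b c d} → a ~ b → c ~ d → a + c ~ b + d
    ~-+ {a} {b} {c} {d} (congruent x y p) (congruent x′ y′ p′) =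
      congruent (x + x′) (y + y′) (trans (shuffle a c x x′ γ)
        (trans (cong₂ _+_ p p′) (sym (shuffle b d y y′ γ))))
      where
      shuffle : ∀ a c x x′ g → a + c + (x + x′) * g ≡ (a + x * g) + (c + x′ * g)
      shuffle = solve-∀

    ~-cancelʳ : ∀ c {a b} → a + c ~ b + c → a ~ b
    ~-cancelʳ c {a} {b} (congruent x y p) =
      congruent x y (+-cancelʳ-≡ c _ _ (trans (swap a x γ c) (trans p (sym (swap b y γ c)))))
      where
      swap : ∀ a x g c → a + x * g + c ≡ a + c + x * g
      swap = solve-∀

    ~-trans : ∀ {a b c} → a ~ b → b ~ c → a ~ c
    ~-trans {a} {b} {c} p q =
      ~-cancelʳ b (~-trans′ (~-+ p q))
      where
      ~-trans′ : a + b ~ b + c → a + b ~ c + b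
      ~-trans′ = subst (a + b ~_) (+-comm b c)

    *γ~0 : ∀ z → z * γ ~ 0
    *γ~0 z = congruent 0 z (+-identityʳ (z * γ))

    ∣⇒~0 : ∀ {a} → γ ∣ a → a ~ 0
    ∣⇒~0 (divides z refl) = *γ~0 z

    ~⇒+* : ∀ {a b} → a ~ b → a ≤ b → ∃ λ z → b ≡ a + z * γ
    ~⇒+* {a} (congruent x y p) a≤b with e , refl ← m≤n⇒∃[o]m+o≡n a≤b
      with divides z refl ← ∣m+n∣m⇒∣n {γ} {y * γ} {e}
             (divides x (trans (+-comm (y * γ) e)
               (sym (+-cancelˡ-≡ a _ _ (trans p (+-assoc a e (y * γ)))))))
             (divides y refl)
      = z , refl

    ~⇒% : .{{_ : NonZero γ}} → ∀ {a b} → a ~ b → a % γ ≡ b % γ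
    ~⇒% {a} {b} (congruent x y p) =
      trans (sym ([m+kn]%n≡m%n a x γ)) (trans (cong (_% γ) p) ([m+kn]%n≡m%n b y γ))

    %~ : .{{_ : NonZero γ}} → ∀ a → a % γ ~ a
    %~ a = congruent (a / γ) 0 (trans (sym (m≡m%n+[m/n]*n a γ)) (sym (+-identityʳ a)))

    -- A labelling `χ` of this kind encodes the cyclic classes: it determines all walk lengths
    -- between two nodes modulo `γ`.
    potential : ∀ {V : Set} {G : Rel V 0ℓ} (χ : V → ℕ) → (∀ {i j} → G i j → χ j ~ χ i + 1) →
                ∀ {l i j} → Walk G l i j → χ j ~ χ i + l
    potential χ edge []              = ~-reflexive (sym (+-identityʳ _))
    potential χ edge (_∷_ {l = l} e w) =
      ~-trans (potential χ edge w)
        (~-trans (~-+ (edge e) (~-reflexive refl)) (~-reflexive (+-assoc _ 1 l)))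

  -- The gain of one, multiplied by `γ`, pays in `small-fibre` for an approach of up to `γ - 1`
  -- steps.
  Wi-mono-< : ∀ {s m} → s < m → suc (Wi s) ≤ Wi m
  Wi-mono-< {zero}  {suc m}       _         = m≤n+m 1 (m ^ 2)
  Wi-mono-< {suc s} {suc (suc m)} (s≤s (s≤s s≤m)) = begin
    suc (s ^ 2 + 1)         ≤⟨ s≤s (+-monoˡ-≤ 1 (*-mono-≤ s≤m (*-monoˡ-≤ 1 s≤m))) ⟩
    suc (m ^ 2 + 1)         ≤⟨ m≤m+n _ (m + m) ⟩
    suc (m ^ 2 + 1) + (m + m) ≡⟨ poly m ⟩
    suc m ^ 2 + 1           ∎
    where
    open ≤-Reasoning
    poly : ∀ m → suc (m * (m * 1) + 1) + (m + m) ≡ suc m * (suc m * 1) + 1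
    poly = solve-∀

  Wi-mono-≤ : ∀ {s m} → s ≤ m → Wi s ≤ Wi m
  Wi-mono-≤ s≤m with m≤n⇒m<n∨m≡n s≤m
  ... | inj₁ s<m  = <⇒≤ (Wi-mono-< s<m)
  ... | inj₂ refl = ≤-refl

  -- Counting the fibres of a function on `Fin q`.

  length-filter-⊎ : ∀ {a p} {A : Set a} {P Q R : Pred A p}
    (P? : Decidable P) (Q? : Decidable Q) (R? : Decidable R) →
    (∀ {x} → P x → Q x ⊎ R x) → (∀ {x} → Q x → P x) → (∀ {x} → R x → P x) →
    (∀ {x} → Q x → ¬ R x) → ∀ xs →
    List.length (filter P? xs) ≡ List.length (filter Q? xs) + List.length (filter R? xs)
  length-filter-⊎ P? Q? R? P⊆Q∪R Q⊆P R⊆P disjoint = go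
    where
    go : ∀ xs → List.length (filter P? xs) ≡
         List.length (filter Q? xs) + List.length (filter R? xs)
    go [] = refl
    go (x ∷ xs) with P? x | Q? x | R? x
    ... | yes _ | yes _ | no  _  = cong suc (go xs)
    ... | yes _ | no  _ | yes _  = trans (cong suc (go xs)) (sym (+-suc _ _))
    ... | no  _ | no  _ | no  _  = go xs
    ... | _     | yes q | yes r  = contradiction r (disjoint q)
    ... | yes p | no ¬q | no ¬r  = contradiction (P⊆Q∪R p) λ { (inj₁ q) → ¬q q ; (inj₂ r) → ¬r r }
    ... | no ¬p | yes q | _      = contradiction (Q⊆P q) ¬p
    ... | no ¬p | _     | yes r  = contradiction (R⊆P r) ¬p

  module _ {q : ℕ} (δ : Fin q → ℕ) where

    fibre : ℕ → List (Fin q)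
    fibre d = filter (λ y → δ y ≟ d) (allFin q)

    private
      below : ℕ → List (Fin q) → List (Fin q)
      below g = filter (λ y → δ y <? g)

      below-suc : ∀ g ys → List.length (below (suc g) ys) ≡
                  List.length (below g ys) + List.length (filter (λ y → δ y ≟ g) ys)
      below-suc g = length-filter-⊎ (λ y → δ y <? suc g) (λ y → δ y <? g) (λ y → δ y ≟ g)
        (λ δ<1+g → m≤n⇒m<n∨m≡n (≤-pred δ<1+g)) m<n⇒m<1+n (λ { refl → ≤-refl })
        (λ { δ<g refl → <-irrefl refl δ<g })

      N : ℕ → ℕ
      N g = List.length (below g (allFin q))

      N≤q : ∀ g → N g ≤ q
      N≤q g = ≤-trans (length-filter (λ y → δ y <? g) (allFin q))
                      (≤-reflexive (length-tabulate {n = q} (λ y → y)))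

      grow : ∀ c a e → (∀ d → d < a + e → c ≤ List.length (fibre d)) → N a + e * c ≤ N (a + e)
      grow c a zero    _     = ≤-reflexive (trans (+-identityʳ _) (cong N (sym (+-identityʳ a))))
      grow c a (suc e) large = begin
        N a + (c + e * c)
          ≡⟨ trans (cong (N a +_) (+-comm c _)) (sym (+-assoc (N a) (e * c) c)) ⟩
        N a + e * c + c        ≤⟨ +-mono-≤ (grow c a e λ d d< → large d (≤-trans d< (+-monoʳ-≤ a (n≤1+n e))))
                                           (large (a + e) (+-monoʳ-< a ≤-refl)) ⟩
        N (a + e) + List.length (fibre (a + e)) ≡⟨ below-suc (a + e) (allFin q) ⟨
        N (suc (a + e))        ≡⟨ cong N (sym (+-suc a e)) ⟩
        N (a + suc e)          ∎
        where open ≤-Reasoning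

    -- If each of the first q % γ + 1 fibres had more than q / γ elements and
    -- each of the others at least q / γ, they would have more than q in total.
    small-fibre : (γ : ℕ) .{{_ : NonZero γ}} →
      ∃ λ d → d < γ × d + γ * Wi (List.length (fibre d)) ≤ Sch γ q
    small-fibre γ
      with anyUpTo? (λ d → List.length (fibre d) ≤? q / γ) (suc (q % γ))
    ... | yes (d , d≤r , small) = d , <-≤-trans d≤r (m%n<n q γ) , (begin
        d + γ * Wi (List.length (fibre d))
          ≤⟨ +-mono-≤ (≤-pred d≤r) (*-monoʳ-≤ γ (Wi-mono-≤ small)) ⟩
        q % γ + γ * Wi (q / γ)             ≡⟨ +-comm (q % γ) _ ⟩
        Sch γ q                            ∎)
      where open ≤-Reasoning
    ... | no ∄small
      with anyUpTo? (λ d → List.length (fibre d) <? q / γ) γ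
    ... | yes (d , d<γ , small) = d , d<γ , (begin
        d + γ * Wi (List.length (fibre d)) ≤⟨ +-monoˡ-≤ _ (<⇒≤ d<γ) ⟩
        γ + γ * Wi (List.length (fibre d)) ≡⟨ *-suc γ _ ⟨
        γ * suc (Wi (List.length (fibre d))) ≤⟨ *-monoʳ-≤ γ (Wi-mono-< small) ⟩
        γ * Wi (q / γ)                     ≤⟨ m≤m+n _ (q % γ) ⟩
        Sch γ q                            ∎)
      where open ≤-Reasoning
    ... | no ∄smaller
      with e , r+e≡γ ← m≤n⇒∃[o]m+o≡n (m%n<n q γ)
      = contradiction total (<⇒≱ (n<1+n q))
      where
      open ≤-Reasoning
      r = q % γ
      m = q / γ
      total : suc q ≤ q
      total = begin
        suc q                          ≡⟨ cong suc (m≡m%n+[m/n]*n q γ) ⟩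
        suc (r + m * γ)                ≡⟨ cong (λ g → suc (r + m * g)) (sym r+e≡γ) ⟩
        suc (r + m * (suc r + e))      ≡⟨ poly r m e ⟩
        suc r * suc m + e * m          ≤⟨ +-monoˡ-≤ (e * m) (≤-trans (m≤n+m _ (N 0)) (grow (suc m) 0 (suc r)
                                            λ d d< → ≰⇒> λ s → ∄small (d , d< , s))) ⟩
        N (suc r) + e * m              ≤⟨ grow m (suc r) e (λ d d< → ≮⇒≥ λ s →
                                            ∄smaller (d , subst (d <_) r+e≡γ d< , s)) ⟩
        N (suc r + e)                  ≤⟨ N≤q _ ⟩
        q                              ∎
        where
        poly : ∀ r m e → suc (r + m * (suc r + e)) ≡ suc r * suc m + e * m
        poly = solve-∀

  -- Schwarz's theorem, by reduction to a single cyclic class.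

  module _ {q γ : ℕ} .{{_ : NonZero γ}} {G : Rel (Fin q) 0ℓ} {T : ℕ} (χ : Fin q → ℕ)
    (edge : ∀ {i j} → G i j → Congruence._~_ γ (χ j) (χ i + 1))
    (full : ∀ l i j → T ≤ l → Congruence._~_ γ (χ j) (χ i + l) → Walk G l i j) where

    open Congruence γ

    private
      class : ∀ {l i j} → Walk G l i j → χ j ~ χ i + l
      class = potential χ edge

      ~-+*γ : ∀ a k → a + k * γ ~ a
      ~-+*γ a k = ~-trans (~-+ (~-reflexive {a} refl) (*γ~0 k)) (~-reflexive (+-identityʳ a))

      -- Cutting such a closed walk after its first `l` steps, or before its last `l`, gives walks
      -- of any length out of and into every node.
      circuit : ∀ l → ∃ λ L → ∀ x → Walk G (l + L) x x
      circuit l with L , eq ← m≤n⇒∃[o]m+o≡n (≤-trans (m≤m+n l T) (m≤m*n (l + T) γ)) =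
        L , λ x → subst (λ l → Walk G l x x) (sym eq) (full _ x x
          (≤-trans (m≤n+m T l) (m≤m*n (l + T) γ)) (~-sym (~-+*γ (χ x) (l + T))))

      forward : ∀ l x → ∃ λ y → Walk G l x y
      forward l x =
        let L , c = circuit l
            y , w , _ = split l (c x)
        in y , w

      backward : ∀ l x → ∃ λ y → Walk G l y x
      backward l x =
        let L , c = circuit l
            y , _ , w = split L (subst (λ l → Walk G l x x) (+-comm l L) (c x))
        in y , w

      module _ {i : Fin q} {d : ℕ} {X : List (Fin q)}
        (X-class : ∀ {y} → y ∈ˡ X → χ y ~ χ i + d) (class-X : ∀ {y} → χ y ~ χ i + d → y ∈ˡ X) where

        e : Fin (List.length X) → Fin q
        e = List.lookup X

        -- Walks of length `γ` stay in their class, so they form a digraph on the positions of `X`;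
        -- it is to this digraph that Wielandt's theorem is applied.
        H : Rel (Fin (List.length X)) 0ℓ
        H s t = Walk G γ (e s) (e t)

        H-closed : ∀ {s y} → Walk G γ (e s) y → ∃ λ t → e t ≡ y
        H-closed {s} {y} c = index y∈X , sym (lookup-index y∈X)
          where
          y∈X = class-X (~-trans (class c) (~-trans (~-+ (X-class (∈-lookup s))
            (~-reflexive (sym (*-identityˡ γ)))) (~-+*γ (χ i + d) 1)))

        -- The threshold is `suc T` because `pullback` requires a nonempty walk.
        H-full : ∀ l s t → suc T ≤ l → Walk H l s t
        H-full (suc n) s t (s≤s T≤n) = pullback e H-closed (chunk (suc n) (full (suc n * γ) (e s) (e t)
          (≤-trans T≤n (≤-trans (n≤1+n n) (m≤m*n (suc n) γ)))
          (~-trans (X-class (∈-lookup t))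
            (~-sym (~-trans (~-+*γ (χ (e s)) (suc n)) (X-class (∈-lookup s)))))))

        -- The walk has three pieces: `d` steps from `i` into the class, `Wi` blocks of `γ` steps
        -- inside it, and the remaining `f` steps into `j`. The node `y′` found `f` steps before `j`
        -- lies in the class because the class of `j` is prescribed.
        class-bound : ∀ l j → d + Wi (List.length X) * γ ≤ l → χ j ~ χ i + l → Walk G l i j
        class-bound l j bound i→j = subst (λ l → Walk G l i j) eq ((u ++ middle) ++ z)
          where
          M = Wi (List.length X)
          f = proj₁ (m≤n⇒∃[o]m+o≡n bound)
          eq : d + M * γ + f ≡ l
          eq = proj₂ (m≤n⇒∃[o]m+o≡n bound)
          y = proj₁ (forward d i)
          u = proj₂ (forward d i)
          y′ = proj₁ (backward f j)
          z = proj₂ (backward f j)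
          y∈X : y ∈ˡ X
          y∈X = class-X (class u)
          y′∈X : y′ ∈ˡ X
          y′∈X = class-X (~-cancelʳ f (~-trans (~-sym (class z)) (~-trans i→j
            (~-trans (~-reflexive (trans (cong (χ i +_) (sym eq)) (shuffle (χ i) d (M * γ) f)))
              (~-+*γ (χ i + d + f) M)))))
            where
            shuffle : ∀ a d m f → a + (d + m + f) ≡ a + d + f + m
            shuffle = solve-∀
          middle : Walk G (M * γ) y y′
          middle = subst₂ (Walk G (M * γ)) (sym (lookup-index y∈X)) (sym (lookup-index y′∈X))
            (flatten (pushforward e (wielandt {G = H} H-full M (index y∈X) (index y′∈X) ≤-refl)))

    -- `small-fibre` selects a class `d` steps after `i` for which the cost in `class-bound` does
    -- not exceed `Sch γ q`.
    schwarz : ∀ l i j → Sch γ q ≤ l → χ j ~ χ i + l → Walk G l i j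
    schwarz l i j Sch≤l i→j
      = let d , d<γ , small = small-fibre δ γ in
        class-bound {X = fibre δ d} X-class (class-X d<γ) l j
          (≤-trans (≤-reflexive (cong (d +_) (*-comm (Wi (List.length (fibre δ d))) γ)))
                   (≤-trans small Sch≤l)) i→j
      where
      -- The residue of χ y - χ i modulo γ.
      δ : Fin q → ℕ
      δ y = (χ y + χ i * pred γ) % γ

      shift : ∀ y → δ y + χ i ~ χ y
      shift y = ~-trans (~-+ (%~ (χ y + χ i * pred γ)) (~-reflexive refl))
        (~-trans (~-reflexive (trans (poly (χ y) (χ i) (pred γ))
                                     (cong (λ g → χ y + χ i * g) (suc-pred γ))))
          (~-+*γ (χ y) (χ i)))
        where
        poly : ∀ a b c → a + b * c + b ≡ a + b * suc c
        poly = solve-∀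

      X-class : ∀ {d y} → y ∈ˡ fibre δ d → χ y ~ χ i + d
      X-class {d} {y} y∈ = ~-trans (~-sym (shift y)) (~-reflexive (trans (+-comm _ (χ i))
        (cong (χ i +_) (proj₂ (∈-filter⁻ (λ y → δ y ≟ d) {xs = allFin q} y∈)))))

      class-X : ∀ {d} → d < γ → ∀ {y} → χ y ~ χ i + d → y ∈ˡ fibre δ d
      class-X {d} d<γ {y} y~ = ∈-filter⁺ (λ y → δ y ≟ d) (∈-allFin y)
        (trans (sym (m<n⇒m%n≡m (m%n<n _ γ)))
          (trans (~⇒% (~-cancelʳ (χ i) (~-trans (shift y) (~-trans y~ (~-reflexive (+-comm (χ i) d))))))
            (m<n⇒m%n≡m d<γ)))

open Digraphs

-- Arithmetic in an ordered field.

module OrderedField (ℛ : Reals) where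

  open Tropical ℛ

  commutativeRing : CommutativeRing 0ℓ 0ℓ
  commutativeRing = record { isCommutativeRing = isCommutativeRing }

  decTotalOrder : DecTotalOrder 0ℓ 0ℓ 0ℓ
  decTotalOrder = record { isDecTotalOrder = isDecTotalOrder }

  open CommutativeRing commutativeRing public using
    ( ring; +-monoid; +-cong; +-congˡ; +-congʳ; *-cong; *-congˡ; *-congʳ; -‿cong; +-assoc; +-comm
    ; +-identityˡ; +-identityʳ; -‿inverseˡ; -‿inverseʳ; *-assoc; *-comm; *-identityˡ; *-identityʳ
    ; distribˡ; distribʳ; zeroˡ; zeroʳ)
  open RingProperties ring public using (-‿distribˡ-*; -‿distribʳ-*; -‿involutive; -0#≈0#)
  open MonoidMult +-monoid public using (×-homo-+)
  open DecTotalOrder decTotalOrder public using (module Eq; total; antisym; ≤-respˡ-≈; ≤-respʳ-≈)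
    renaming (refl to ≤-refl; reflexive to ≤-reflexive; trans to ≤-trans)
  open import Relation.Binary.Reasoning.PartialOrder (DecTotalOrder.poset decTotalOrder)

  +-mono-≤ : ∀ {x y u v} → x ≤ y → u ≤ v → x + u ≤ y + v
  +-mono-≤ {x} {y} {u} {v} x≤y u≤v = begin
    x + u ≤⟨ +-monoˡ-≤ u x≤y ⟩
    y + u ≈⟨ +-comm y u ⟩
    u + y ≤⟨ +-monoˡ-≤ y u≤v ⟩
    v + y ≈⟨ +-comm v y ⟩
    y + v ∎

  x-y+y≈x : ∀ x y → x - y + y ≈ x
  x-y+y≈x x y = Eq.trans (+-assoc x (- y) y) (Eq.trans (+-congˡ (-‿inverseˡ y)) (+-identityʳ x))

  x+y-y≈x : ∀ x y → x + y - y ≈ x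
  x+y-y≈x x y = Eq.trans (+-assoc x y (- y)) (Eq.trans (+-congˡ (-‿inverseʳ y)) (+-identityʳ x))

  +-cancelʳ-≤ : ∀ z {x y} → x + z ≤ y + z → x ≤ y
  +-cancelʳ-≤ z {x} {y} x+z≤y+z = begin
    x         ≈⟨ x+y-y≈x x z ⟨
    x + z - z ≤⟨ +-monoˡ-≤ (- z) x+z≤y+z ⟩
    y + z - z ≈⟨ x+y-y≈x y z ⟩
    y         ∎

  x≤y⇒0≤y-x : ∀ {x y} → x ≤ y → 0# ≤ y - x
  x≤y⇒0≤y-x {x} x≤y = ≤-respˡ-≈ (-‿inverseʳ x) (+-monoˡ-≤ (- x) x≤y)

  0≤y-x⇒x≤y : ∀ {x y} → 0# ≤ y - x → x ≤ y
  0≤y-x⇒x≤y {x} {y} 0≤y-x = begin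
    x         ≈⟨ +-identityˡ x ⟨
    0# + x    ≤⟨ +-monoˡ-≤ x 0≤y-x ⟩
    y - x + x ≈⟨ x-y+y≈x y x ⟩
    y         ∎

  neg-mono-≤ : ∀ {x y} → x ≤ y → - y ≤ - x
  neg-mono-≤ {x} {y} x≤y = 0≤y-x⇒x≤y (≤-respʳ-≈
    (Eq.trans (+-comm y (- x)) (+-congˡ (Eq.sym (-‿involutive y)))) (x≤y⇒0≤y-x x≤y))

  x≤0⇒0≤-x : ∀ {x} → x ≤ 0# → 0# ≤ - x
  x≤0⇒0≤-x x≤0 = ≤-respˡ-≈ -0#≈0# (neg-mono-≤ x≤0)

  *-monoʳ-≤ : ∀ z {x y} → 0# ≤ z → x ≤ y → x * z ≤ y * z
  *-monoʳ-≤ z {x} {y} 0≤z x≤y = 0≤y-x⇒x≤y (≤-respʳ-≈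
    (Eq.trans (distribʳ z y (- x)) (+-congˡ (Eq.sym (-‿distribˡ-* x z))))
    (*-nonneg (x≤y⇒0≤y-x x≤y) 0≤z))

  *-antiʳ-≤ : ∀ z {x y} → z ≤ 0# → x ≤ y → y * z ≤ x * z
  *-antiʳ-≤ z {x} {y} z≤0 x≤y = begin
    y * z         ≈⟨ -‿involutive (y * z) ⟨
    - - (y * z)   ≈⟨ -‿cong (-‿distribʳ-* y z) ⟩
    - (y * - z)   ≤⟨ neg-mono-≤ (*-monoʳ-≤ (- z) (x≤0⇒0≤-x z≤0) x≤y) ⟩
    - (x * - z)   ≈⟨ -‿cong (-‿distribʳ-* x z) ⟨
    - - (x * z)   ≈⟨ -‿involutive (x * z) ⟩
    x * z         ∎

  0≤1 : 0# ≤ 1#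
  0≤1 with total 0# 1#
  ... | inj₁ 0≤1 = 0≤1
  ... | inj₂ 1≤0 = ≤-respˡ-≈ (zeroˡ 1#) (≤-respʳ-≈ (*-identityˡ 1#) (*-antiʳ-≤ 1# 1≤0 1≤0))

  1≰0 : ¬ 1# ≤ 0#
  1≰0 1≤0 = 0≉1 (antisym 0≤1 1≤0)

  0≤⁻¹ : ∀ {x} → 0# ≤ x → ¬ x ≈ 0# → 0# ≤ x ⁻¹
  0≤⁻¹ {x} 0≤x x≉0 with total 0# (x ⁻¹)
  ... | inj₁ 0≤x⁻¹ = 0≤x⁻¹
  ... | inj₂ x⁻¹≤0 = contradiction
    (≤-respˡ-≈ (⁻¹-inverseʳ x x≉0) (≤-respʳ-≈ (zeroˡ _) (*-antiʳ-≤ (x ⁻¹) x⁻¹≤0 0≤x))) 1≰0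

  ⁻¹≤0 : ∀ {x} → x ≤ 0# → ¬ x ≈ 0# → x ⁻¹ ≤ 0#
  ⁻¹≤0 {x} x≤0 x≉0 with total (x ⁻¹) 0#
  ... | inj₁ x⁻¹≤0 = x⁻¹≤0
  ... | inj₂ 0≤x⁻¹ = contradiction
    (≤-respˡ-≈ (⁻¹-inverseʳ x x≉0) (≤-respʳ-≈ (zeroˡ _) (*-monoʳ-≤ (x ⁻¹) 0≤x⁻¹ x≤0))) 1≰0

  x/y*y≈x : ∀ x {y} → ¬ y ≈ 0# → x / y * y ≈ x
  x/y*y≈x x {y} y≉0 = Eq.trans (*-assoc x (y ⁻¹) y) (Eq.trans
    (*-congˡ (Eq.trans (*-comm (y ⁻¹) y) (⁻¹-inverseʳ y y≉0))) (*-identityʳ x))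

  x*y/y≈x : ∀ x {y} → ¬ y ≈ 0# → x * y / y ≈ x
  x*y/y≈x x {y} y≉0 = Eq.trans (*-assoc x y (y ⁻¹)) (Eq.trans
    (*-congˡ (⁻¹-inverseʳ y y≉0)) (*-identityʳ x))

  fromNat-+ : ∀ m n → fromNat (m ℕ.+ n) ≈ fromNat m + fromNat n
  fromNat-+ = ×-homo-+ 1#

  0≤fromNat : ∀ m → 0# ≤ fromNat m
  0≤fromNat zero    = ≤-refl
  0≤fromNat (suc m) = ≤-respˡ-≈ (+-identityˡ 0#) (+-mono-≤ 0≤1 (0≤fromNat m))

  -- Brings bounds on lengths, obtained by real arithmetic, back to ℕ.
  fromNat-cancel-≤ : ∀ {m n} → fromNat m ≤ fromNat n → m ℕ.≤ n
  fromNat-cancel-≤ {zero}  {n}     _ = ℕ.z≤n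
  fromNat-cancel-≤ {suc m} {zero}  p = contradiction (begin
    1#              ≈⟨ +-identityʳ 1# ⟨
    1# + 0#         ≤⟨ +-mono-≤ ≤-refl (0≤fromNat m) ⟩
    fromNat (suc m) ≤⟨ p ⟩
    0#              ∎) 1≰0
  fromNat-cancel-≤ {suc m} {suc n} p = ℕ.s≤s (fromNat-cancel-≤
    (+-cancelʳ-≤ 1# (≤-respˡ-≈ (+-comm 1# _) (≤-respʳ-≈ (+-comm 1# _) p))))

  fromNat-mono-≤ : ∀ {m n} → m ℕ.≤ n → fromNat m ≤ fromNat n
  fromNat-mono-≤ {n = n} ℕ.z≤n = 0≤fromNat n
  fromNat-mono-≤ (ℕ.s≤s m≤n)   = +-mono-≤ ≤-refl (fromNat-mono-≤ m≤n)

  fromNat≉0 : ∀ {m} → 1 ℕ.≤ m → ¬ fromNat m ≈ 0#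
  fromNat≉0 1≤m m≈0 with () ← ℕ.≤-trans 1≤m (fromNat-cancel-≤ {n = 0} (≤-reflexive m≈0))

-- Max-plus arithmetic and attained maxima.

module MaxPlus (ℛ : Reals) where

  open Tropical ℛ
  open OrderedField ℛ

  open TotalOrder ℝmax-totalOrder public using () renaming
    ( refl to ≤₋-refl; trans to ≤₋-trans; reflexive to ≤₋-reflexive; antisym to ≤₋-antisym
    ; poset to ≤₋-poset; module Eq to ≈₋)

  private variable
    n k : ℕ
    x y u v : ℝmax
    a b : Carrier

  ⊗-mono : x ≤₋ y → u ≤₋ v → x ⊗ u ≤₋ y ⊗ v
  ⊗-mono (⊥₋≤ _) _        = ⊥₋≤ _
  ⊗-mono [ _ ]   (⊥₋≤ _)  = ⊥₋≤ _
  ⊗-mono [ p ]   [ q ]    = [ +-mono-≤ p q ]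

  ⊗-assoc : ∀ x y z → x ⊗ y ⊗ z ≈₋ x ⊗ (y ⊗ z)
  ⊗-assoc ⊥₋    y     z     = ∙≈∙
  ⊗-assoc [ x ] ⊥₋    z     = ∙≈∙
  ⊗-assoc [ x ] [ y ] ⊥₋    = ∙≈∙
  ⊗-assoc [ x ] [ y ] [ z ] = [ +-assoc x y z ]

  ⊗-comm : ∀ x y → x ⊗ y ≈₋ y ⊗ x
  ⊗-comm ⊥₋    ⊥₋    = ∙≈∙
  ⊗-comm ⊥₋    [ y ] = ∙≈∙
  ⊗-comm [ x ] ⊥₋    = ∙≈∙
  ⊗-comm [ x ] [ y ] = [ +-comm x y ]

  ⊗-identityˡ : ∀ x → [ 0# ] ⊗ x ≈₋ x
  ⊗-identityˡ ⊥₋    = ∙≈∙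
  ⊗-identityˡ [ x ] = [ +-identityˡ x ]

  ⊗-identityʳ : ∀ x → x ⊗ [ 0# ] ≈₋ x
  ⊗-identityʳ ⊥₋    = ∙≈∙
  ⊗-identityʳ [ x ] = [ +-identityʳ x ]

  ⊗-cong : x ≈₋ y → u ≈₋ v → x ⊗ u ≈₋ y ⊗ v
  ⊗-cong p q = ≤₋-antisym (⊗-mono (≤₋-reflexive p) (≤₋-reflexive q))
    (⊗-mono (≤₋-reflexive (≈₋.sym p)) (≤₋-reflexive (≈₋.sym q)))

  ⊗≤ˡ : y ≤₋ [ 0# ] → x ⊗ y ≤₋ x
  ⊗≤ˡ {x = x} y≤0 = ≤₋-trans (⊗-mono ≤₋-refl y≤0) (≤₋-reflexive (⊗-identityʳ x))

  ⊗≤ʳ : x ≤₋ [ 0# ] → x ⊗ y ≤₋ y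
  ⊗≤ʳ {y = y} x≤0 = ≤₋-trans (⊗-mono x≤0 ≤₋-refl) (≤₋-reflexive (⊗-identityˡ y))

  ⊗-finite : x ⊗ y ≡ [ a ] → ∃₂ λ b c → x ≡ [ b ] × y ≡ [ c ]
  ⊗-finite {[ b ]} {[ c ]} _ = b , c , ≡.refl , ≡.refl

  finite-≤ : [ a ] ≤₋ x → ∃ λ b → x ≡ [ b ]
  finite-≤ [ _ ] = _ , ≡.refl

  ⊕-sel : ∀ x y → x ⊕ y ≡ x ⊎ x ⊕ y ≡ y
  ⊕-sel x y with TotalOrder.total ℝmax-totalOrder y x
  ... | inj₁ _ = inj₁ ≡.refl
  ... | inj₂ _ = inj₂ ≡.refl

  x≤x⊕y : ∀ x y → x ≤₋ x ⊕ y
  x≤x⊕y = NaturalMax.x≤x⊔y ℝmax-totalOrder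

  y≤x⊕y : ∀ x y → y ≤₋ x ⊕ y
  y≤x⊕y x y = NaturalMax.x≤y⊔x ℝmax-totalOrder x y

  ≤-⨁ : ∀ (f : Fin n → ℝmax) i → f i ≤₋ ⨁ f
  ≤-⨁ f Fin.zero    = x≤x⊕y (f Fin.zero) (⨁ λ i → f (Fin.suc i))
  ≤-⨁ f (Fin.suc i) = ≤₋-trans (≤-⨁ (λ i → f (Fin.suc i)) i) (y≤x⊕y (f Fin.zero) _)

  -- As `⊕` returns one of its arguments, the maximum is attained up to propositional equality; the
  -- empty maximum is `ε`, hence excluded.
  ⨁-attained : ∀ (f : Fin n → ℝmax) → ⨁ f ≡ [ a ] → ∃ λ i → f i ≡ [ a ]
  ⨁-attained {suc n} f eq with ⊕-sel (f Fin.zero) (⨁ λ i → f (Fin.suc i))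
  ... | inj₁ p = Fin.zero , ≡.trans (≡.sym p) eq
  ... | inj₂ p with i , q ← ⨁-attained (λ i → f (Fin.suc i)) (≡.trans (≡.sym p) eq) = Fin.suc i , q

  ⊠-≥ : ∀ (A B : Matrix n) i l j → A i l ⊗ B l j ≤₋ (A ⊠ B) i j
  ⊠-≥ A B i l j = ≤-⨁ (λ l → A i l ⊗ B l j) l

  ⊠-attained : ∀ (A B : Matrix n) {i j} → (A ⊠ B) i j ≡ [ a ] → ∃ λ l → ∃₂ λ b c →
    A i l ≡ [ b ] × B l j ≡ [ c ] × b + c ≡ a
  ⊠-attained A B {i} {j} eq with ⨁-attained _ eq
  ... | l , p with b , c , Ail , Blj ← ⊗-finite {A i l} {B l j} p =
    l , b , c , Ail , Blj , injective (≡.trans (≡.sym (≡.cong₂ _⊗_ Ail Blj)) p)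
    where
    injective : ∀ {a b} → _≡_ {A = ℝmax} [ a ] [ b ] → a ≡ b
    injective ≡.refl = ≡.refl

  ⊔±-≤ : ∀ {x y z : ℝ̄} → x ⊔± y ≤± z → x ≤± z × y ≤± z
  ⊔±-≤ {x} {y} le = ℝ̄.trans (NaturalMax.x≤x⊔y ℝ̄-totalOrder x y) le
                  , ℝ̄.trans (NaturalMax.x≤y⊔x ℝ̄-totalOrder x y) le
    where module ℝ̄ = TotalOrder ℝ̄-totalOrder

  ⨆-≤ : ∀ (f : Fin n → ℝ̄) {z} → ⨆ f ≤± z → ∀ i → f i ≤± z
  ⨆-≤ f le Fin.zero    = proj₁ (⊔±-≤ {f Fin.zero} le)
  ⨆-≤ f le (Fin.suc i) = ⨆-≤ (λ i → f (Fin.suc i)) (proj₂ (⊔±-≤ {f Fin.zero} le)) i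

-- Duplicate-free lists in a subset, and its enumeration.

unique-length : ∀ {n} {X : Subset n} {xs} → Unique xs → All (_∈ X) xs → List.length xs ℕ.≤ ∣ X ∣
unique-length []        []         = ℕ.z≤n
unique-length {X = X} (x∉xs ∷ uxs) (x∈X ∷ xs∈X) = ℕ.≤-trans
  (ℕ.s≤s (unique-length uxs (All.zipWith
    (λ (y∈X , x≢y) → x∈p∧x≢y⇒x∈p-y y∈X (λ y≡x → x≢y (sym y≡x))) (xs∈X , x∉xs))))
  (x∈p⇒∣p-x∣<∣p∣ x∈X)

-- The origin of each `n ∸ q` in the bounds: the lists will consist of distinct noncritical nodes of
-- a walk.
unique-length-∁ : ∀ {n} (X : Subset n) {xs} → Unique xs → All (_∉ X) xs → List.length xs ℕ.≤ n ∸ ∣ X ∣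
unique-length-∁ X uxs xs∉X = subst (_ ℕ.≤_) (∣∁p∣≡n∸∣p∣ X) (unique-length uxs (All.map x∉p⇒x∈∁p xs∉X))

-- Makes `Fin q` the node set of the critical digraph, so that Schwarz's theorem yields a bound in
-- `q` rather than `n`.
enumeration : ∀ {n} (X : Subset n) →
  Σ[ e ∈ (Fin ∣ X ∣ → Fin n) ] (∀ s → e s ∈ X) × (∀ {x} → x ∈ X → ∃ λ s → e s ≡ x)
enumeration [] = (λ ()) , (λ ()) , λ ()
enumeration (inside ∷ X) with e , e∈X , onto ← enumeration X =
  (λ { Fin.zero → Fin.zero ; (Fin.suc s) → Fin.suc (e s) }) ,
  (λ { Fin.zero → here ; (Fin.suc s) → there (e∈X s) }) ,
  λ { here → Fin.zero , refl ; (there x∈X) → let s , eq = onto x∈X in Fin.suc s , cong Fin.suc eq }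
enumeration (outside ∷ X) with e , e∈X , onto ← enumeration X =
  (λ s → Fin.suc (e s)) , (λ s → there (e∈X s)) ,
  λ { (there x∈X) → let s , eq = onto x∈X in s , cong Fin.suc eq }

-- Cutting walks at chosen nodes.

module _ {ℓ} {V : Set} {G : Rel V ℓ} where

  private variable
    u v x : V
    p : Level
    P : Pred V p

  edges-◅◅ : (w : Star G u v) (w′ : Star G v x) → edges (w ◅◅ w′) ≡ edges w List.++ edges w′
  edges-◅◅ Star.ε  w′ = refl
  edges-◅◅ (e ◅ w) w′ = cong (_ ∷_) (edges-◅◅ w w′)

  length-◅◅ : (w : Star G u v) (w′ : Star G v x) → length (w ◅◅ w′) ≡ length w ℕ.+ length w′
  length-◅◅ w w′ = trans (cong List.length (edges-◅◅ w w′)) (List.length-++ (edges w))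

  sources-◅◅ : (w : Star G u v) (w′ : Star G v x) → sources (w ◅◅ w′) ≡ sources w List.++ sources w′
  sources-◅◅ w w′ = trans (cong (List.map proj₁) (edges-◅◅ w w′)) (List.map-++ proj₁ (edges w) (edges w′))

  length-sources : (w : Star G u v) → List.length (sources w) ≡ length w
  length-sources w = List.length-map proj₁ (edges w)

  length-targets : (w : Star G u v) → List.length (targets w) ≡ length w
  length-targets w = List.length-map proj₂ (edges w)

  All-nodes : (w : Star G u v) → All P (sources w) → P v → All P (nodes w)
  All-nodes Star.ε  []        Pv = Pv ∷ []
  All-nodes (e ◅ w) (Pu ∷ ps) Pv = Pu ∷ All-nodes w ps Pv

  All-sources : (w : Star G u v) → All P (nodes w) → All P (sources w)
  All-sources Star.ε  _         = []
  All-sources (e ◅ w) (Pu ∷ ps) = Pu ∷ All-sources w ps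

  All-last : (w : Star G u v) → All P (nodes w) → P v
  All-last Star.ε  (Pv ∷ _)  = Pv
  All-last (e ◅ w) (_  ∷ ps) = All-last w ps

  unique-sources : (w : Star G u v) → IsPath w → Unique (sources w)
  unique-sources Star.ε  _              = []
  unique-sources (e ◅ w) (u∉w ∷ unique) = All-sources w u∉w ∷ unique-sources w unique

  split-at : (w : Star G u v) → x ∈ˡ nodes w → Σ[ w₁ ∈ Star G u x ] Σ[ w₂ ∈ Star G x v ] w ≡ w₁ ◅◅ w₂
  split-at w       (here refl) = Star.ε , w , refl
  split-at (e ◅ w) (there x∈w) with w₁ , w₂ , refl ← split-at w x∈w = e ◅ w₁ , w₂ , refl

  path-suffix : (w₁ : Star G u x) (w₂ : Star G x v) → IsPath (w₁ ◅◅ w₂) → IsPath w₂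
  path-suffix Star.ε   w₂ unique       = unique
  path-suffix (e ◅ w₁) w₂ (_ ∷ unique) = path-suffix w₁ w₂ unique

  -- With `P` criticality, the piece `w₁` competes in the definition of w*; the piece `w₂` of
  -- `last-visit` does so for v*.
  first-visit : Decidable P → (w : Star G u v) → All (λ y → ¬ P y) (nodes w) ⊎
    ∃ λ x → Σ[ w₁ ∈ Star G u x ] Σ[ w₂ ∈ Star G x v ]
      P x × All (λ y → ¬ P y) (sources w₁) × w ≡ w₁ ◅◅ w₂
  first-visit {u = u} P? w with P? u
  ... | yes Pu = inj₂ (u , Star.ε , w , Pu , [] , refl)
  first-visit P? Star.ε  | no ¬Pu = inj₁ (¬Pu ∷ [])
  first-visit P? (e ◅ w) | no ¬Pu with first-visit P? w
  ... | inj₁ ¬Pw = inj₁ (¬Pu ∷ ¬Pw)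
  ... | inj₂ (x , w₁ , w₂ , Px , ¬Pw₁ , refl) = inj₂ (x , e ◅ w₁ , w₂ , Px , ¬Pu ∷ ¬Pw₁ , refl)

  last-visit : Decidable P → (w : Star G u v) → All (λ y → ¬ P y) (nodes w) ⊎
    ∃ λ x → Σ[ w₁ ∈ Star G u x ] Σ[ w₂ ∈ Star G x v ]
      P x × All (λ y → ¬ P y) (targets w₂) × w ≡ w₁ ◅◅ w₂
  last-visit {u = u} P? Star.ε with P? u
  ... | yes Pu = inj₂ (u , Star.ε , Star.ε , Pu , [] , refl)
  ... | no ¬Pu = inj₁ (¬Pu ∷ [])
  last-visit {u = u} P? (e ◅ w) with last-visit P? w
  ... | inj₂ (x , w₁ , w₂ , Px , ¬Pw₂ , refl) = inj₂ (x , e ◅ w₁ , w₂ , Px , ¬Pw₂ , refl)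
  ... | inj₁ ¬Pw with P? u
  ...   | yes Pu = inj₂ (u , Star.ε , e ◅ w , Pu , ¬Pw , refl)
  ...   | no ¬Pu = inj₁ (¬Pu ∷ ¬Pw)

  toWalk : {H : Rel V 0ℓ} → (∀ {i j} → G i j → H i j) → (w : Star G u v) → Walk H (length w) u v
  toWalk f Star.ε  = []
  toWalk f (e ◅ w) = f e ∷ toWalk f w

-- Weights of walks and the erasure of cycles.

module WeightedDigraph (ℛ : Reals) where

  open Tropical ℛ
  open MaxPlus ℛ

  ⊗-commutativeMonoid : CommutativeMonoid 0ℓ 0ℓ
  ⊗-commutativeMonoid = record
    { _≈_ = _≈₋_ ; _∙_ = _⊗_ ; ε = [ 0# ]
    ; isCommutativeMonoid = record
      { isMonoid = record
        { isSemigroup = record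
          { isMagma = record { isEquivalence = ≈₋.isEquivalence ; ∙-cong = ⊗-cong }
          ; assoc = ⊗-assoc }
        ; identity = ⊗-identityˡ , ⊗-identityʳ }
      ; comm = ⊗-comm } }

  open CommutativeMonoidSolver ⊗-commutativeMonoid using (solve; _⊜_) renaming (_⊕_ to _⊞ₑ_)
  open import Relation.Binary.Reasoning.PartialOrder ≤₋-poset

  -- `power ε d` is `[ 0# ]` for `d = 0` and `ε` otherwise. Thus for λ* = `ε` the bound in
  -- `erase-cycles` forces `d = 0` for walks of finite weight.
  power : ℝmax → ℕ → ℝmax
  power x zero    = [ 0# ]
  power x (suc d) = x ⊗ power x d

  power-+ : ∀ x d d′ → power x (d ℕ.+ d′) ≈₋ power x d ⊗ power x d′
  power-+ x zero    d′ = ≈₋.sym (⊗-identityˡ _)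
  power-+ x (suc d) d′ = ≈₋.trans (⊗-cong ≈₋.refl (power-+ x d d′)) (≈₋.sym (⊗-assoc x _ _))

  module _ {ℓ} {V : Set} {G : Rel V ℓ} (ω : ∀ {u v} → G u v → ℝmax) where

    weight-◅◅ : ∀ {u v x} (w : Star G u v) (w′ : Star G v x) →
                weight ω (w ◅◅ w′) ≈₋ weight ω w ⊗ weight ω w′
    weight-◅◅ Star.ε  w′ = ≈₋.sym (⊗-identityˡ _)
    weight-◅◅ (e ◅ w) w′ = ≈₋.trans (⊗-cong ≈₋.refl (weight-◅◅ w w′)) (≈₋.sym (⊗-assoc _ _ _))

    weight≤0 : (∀ {u v} (e : G u v) → ω e ≤₋ [ 0# ]) → ∀ {u v} (w : Star G u v) → weight ω w ≤₋ [ 0# ]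
    weight≤0 ω≤0 Star.ε  = ≤₋-refl
    weight≤0 ω≤0 (e ◅ w) = ≤₋-trans (⊗≤ʳ (ω≤0 e)) (weight≤0 ω≤0 w)

    -- Induction from the end of the walk: if the source of a new first edge recurs on the path
    -- built so far, the new edge and the initial piece up to that node form a cycle, which is
    -- dropped. Here `d` counts the erased edges. `P` is required of sources only, because the walks
    -- measured by w* end in a critical node.
    erase-cycles : ∀ {p} {P : Pred V p} {x} → DecidableEquality V →
      (∀ {v} (c : Star G v v) → IsCycle c → All P (sources c) → weight ω c ≤₋ power x (length c)) →
      ∀ {u v} (w : Star G u v) → All P (sources w) →
      Σ[ w′ ∈ Star G u v ] IsPath w′ × All P (sources w′) ×
        ∃ λ d → length w ≡ length w′ ℕ.+ d × weight ω w ≤₋ weight ω w′ ⊗ power x d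
    erase-cycles _≟_ cycle≤ Star.ε Pw =
      Star.ε , [] ∷ [] , [] , 0 , refl , ≤₋-reflexive (≈₋.sym (⊗-identityʳ _))
    erase-cycles {P = P} {x = x} _≟_ cycle≤ {u} (e ◅ w) (Pu ∷ Pw)
      with w′ , path , Pw′ , d , len , weight≤ ← erase-cycles {x = x} _≟_ cycle≤ w Pw
      with mem? _≟_ u (nodes w′)
    ... | no u∉w′ = e ◅ w′ , ¬Any⇒All¬ _ u∉w′ ∷ path , Pu ∷ Pw′ , d , cong suc len
      , ≤₋-trans (⊗-mono ≤₋-refl weight≤) (≤₋-reflexive (≈₋.sym (⊗-assoc _ _ _)))
    ... | yes u∈w′ with w₁ , w₂ , refl ← split-at w′ u∈w′
      = w₂ , path-suffix w₁ w₂ path , proj₂ P₁₂ , suc (length w₁) ℕ.+ d , trans (cong suc len) lengths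
      , (begin
        ω e ⊗ weight ω w                                          ≤⟨ ⊗-mono ≤₋-refl weight≤ ⟩
        ω e ⊗ (weight ω (w₁ ◅◅ w₂) ⊗ power x d)
          ≈⟨ ⊗-cong (≈₋.refl {ω e}) (⊗-cong (weight-◅◅ w₁ w₂) ≈₋.refl) ⟩
        ω e ⊗ (weight ω w₁ ⊗ weight ω w₂ ⊗ power x d)
          ≈⟨ solve 4 (λ a b c d → a ⊞ₑ ((b ⊞ₑ c) ⊞ₑ d) ⊜ c ⊞ₑ ((a ⊞ₑ b) ⊞ₑ d)) ≈₋.refl
             (ω e) (weight ω w₁) (weight ω w₂) (power x d) ⟩
        weight ω w₂ ⊗ (weight ω (e ◅ w₁) ⊗ power x d)
          ≤⟨ ⊗-mono ≤₋-refl (⊗-mono (cycle≤ (e ◅ w₁) (ℕ.s≤s ℕ.z≤n) (Pu ∷ proj₁ P₁₂)) ≤₋-refl) ⟩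
        weight ω w₂ ⊗ (power x (suc (length w₁)) ⊗ power x d)
          ≈⟨ ⊗-cong ≈₋.refl (power-+ x (suc (length w₁)) d) ⟨
        weight ω w₂ ⊗ power x (suc (length w₁) ℕ.+ d)             ∎)
      where
      P₁₂ : All P (sources w₁) × All P (sources w₂)
      P₁₂ = All.++⁻ (sources w₁) (subst (All P) (sources-◅◅ w₁ w₂) Pw′)
      poly : ∀ a b c → suc (a ℕ.+ b ℕ.+ c) ≡ b ℕ.+ (suc a ℕ.+ c)
      poly = solve-∀
      lengths : suc (length (w₁ ◅◅ w₂) ℕ.+ d) ≡ length w₂ ℕ.+ (suc (length w₁) ℕ.+ d)
      lengths = trans (cong (λ l → suc (l ℕ.+ d)) (length-◅◅ w₁ w₂)) (poly (length w₁) (length w₂) d)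

edge-source : ∀ {ℓ} {V : Set} {G : Rel V ℓ} {u v x} (w : Star G u v) → x ∈ˡ nodes w →
              x ∈ˡ sources w ⊎ x ≡ v
edge-source Star.ε  (here refl) = inj₂ refl
edge-source (e ◅ w) (here refl) = inj₁ (here refl)
edge-source (e ◅ w) (there x∈w) with edge-source w x∈w
... | inj₁ x∈ = inj₁ (there x∈)
... | inj₂ eq = inj₂ eq

cycle-sources : ∀ {ℓ} {V : Set} {G : Rel V ℓ} {v x} (w : Star G v v) → IsCycle w →
                x ∈ˡ nodes w → x ∈ˡ sources w
cycle-sources w@(_ ◅ _) _ x∈w with edge-source w x∈w
... | inj₁ x∈   = x∈
... | inj₂ refl = here refl

-- Trellis walks, matrix products and cyclic classes.

module Setup (ℛ : Reals) {p : Level} {n : ℕ} {𝒳 : Pred (Tropical.Matrix ℛ n) p}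
  (setting : Tropical.Setting ℛ 𝒳) where

  open Tropical ℛ
  open OrderedField ℛ using (-‿inverseʳ)
  open MaxPlus ℛ
  open WeightedDigraph ℛ
  open Setting setting

  critical-node? : ∀ {k} → Decidable (λ (y : Fin n × Fin (suc k)) → proj₁ y ∈ 𝓝c)
  critical-node? y = proj₁ y ∈? 𝓝c

  Aˢᵘᵖ≤0 : ∀ i j → Aˢᵘᵖ i j ≤₋ [ 0# ]
  Aˢᵘᵖ≤0 i j with i 𝓔c? j
  ... | yes c = ≤₋-reflexive (criticalˢᵘᵖ i j c)
  ... | no ¬c = othersˢᵘᵖ i j ¬c

  𝒴≤Aˢᵘᵖ : ∀ {A} → 𝒴 A → ∀ i j → A i j ≤₋ Aˢᵘᵖ i j
  𝒴≤Aˢᵘᵖ {A} A∈𝒴 i j = proj₁ (isSupremum i j) (A i j) (A , A∈𝒴 , ≈₋.refl)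

  𝒴-finite⇒E : ∀ {A a i j} → 𝒴 A → A i j ≡ [ a ] → E i j
  𝒴-finite⇒E {A} {a} {i} {j} (B , μ , B∈𝒳 , _ , A≈B-μ) Aij≡a =
    Equivalence.from (digraph B B∈𝒳 i j) λ Bij≡ε → ⊖-finite (A≈B-μ i j) Bij≡ε
    where
    ⊖-finite : ∀ {x} → A i j ≈₋ x ⊖ μ → ¬ x ≡ ε
    ⊖-finite A≈ refl with () ← subst (_≈₋ ε) Aij≡a A≈

  𝓔c⇒E : ∀ {i j} → 𝓔c i j → E i j
  𝓔c⇒E {i} {j} c = Equivalence.from (digraphˢᵘᵖ i j) λ A≡ε → finite A≡ε (criticalˢᵘᵖ i j c)
    where
    finite : ∀ {x} → x ≡ ε → ¬ x ≈₋ [ 0# ]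
    finite refl ()

  E-connected : ∀ i j → Star E i j
  E-connected i j with A , A∈𝒳 ← nonempty =
    Star.map (λ {i} {j} → Equivalence.from (digraph A A∈𝒳 i j)) (irreducible A A∈𝒳 {i} {j} _ _)

  𝓔c-nodes : ∀ {i j} → 𝓔c i j → i ∈ 𝓝c × j ∈ 𝓝c
  𝓔c-nodes {i} {j} c with v , w , crit , ij∈w ← Equivalence.to (critEdgesˢᵘᵖ i j) c =
    Equivalence.from (critNodesˢᵘᵖ i) (v , w , crit , i∈w) ,
    Equivalence.from (critNodesˢᵘᵖ j) (v , w , crit , there (∈-map⁺ proj₂ ij∈w))
    where
    nodes⊇sources : ∀ {u v x} (w : Star (𝒟 Aˢᵘᵖ) u v) → x ∈ˡ sources w → x ∈ˡ nodes w
    nodes⊇sources (e ◅ w) (here refl) = here refl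
    nodes⊇sources (e ◅ w) (there x∈w) = there (nodes⊇sources w x∈w)
    i∈w = nodes⊇sources w (∈-map⁺ proj₁ ij∈w)

  𝓔c-walk-end : ∀ {l i j} → i ∈ 𝓝c → Walk 𝓔c l i j → j ∈ 𝓝c
  𝓔c-walk-end i∈ []      = i∈
  𝓔c-walk-end i∈ (c ∷ w) = 𝓔c-walk-end (proj₂ (𝓔c-nodes c)) w

  successor : ∀ {i} → i ∈ 𝓝c → ∃ λ j → 𝓔c i j
  successor {i} i∈𝓝c with v , w , crit , i∈w ← Equivalence.to (critNodesˢᵘᵖ i) i∈𝓝c
    with (_ , j) , ij∈w , refl ← ∈-map⁻ proj₁ (cycle-sources w (proj₁ crit) i∈w)
    = j , Equivalence.from (critEdgesˢᵘᵖ i j) (v , w , crit , ij∈w)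

  module _ {k : ℕ} (As : Vec (Matrix n) k) where

    open Trellis As using (Edge; step)

    level-length : ∀ {a b} (w : Star Edge a b) → toℕ (proj₂ a) ℕ.+ length w ≡ toℕ (proj₂ b)
    level-length Star.ε         = ℕ.+-identityʳ _
    level-length (step l _ ◅ w) = trans (ℕ.+-suc _ (length w))
      (trans (cong (λ x → suc (x ℕ.+ length w)) (toℕ-inject₁ l)) (level-length w))

    project : ∀ {a b} → Edge a b → E (proj₁ a) (proj₁ b)
    project (step _ e) = e

    toWalkᴱ : ∀ {a b} (w : Star Edge a b) → Walk E (length w) (proj₁ a) (proj₁ b)
    toWalkᴱ Star.ε  = []
    toWalkᴱ (e ◅ w) = project e ∷ toWalkᴱ w

  module _ {k : ℕ} (A : Matrix n) (As : Vec (Matrix n) k) where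

    open Trellis using (Edge; ω; step)

    -- The trellis of `As` is that of `A ∷ As` without level 0, with levels renumbered; `shift` and
    -- `unshift` let inductions peel off the first factor of the product.
    shift : ∀ {a b} (w : Star (Edge As) a b) →
      Σ[ w′ ∈ Star (Edge (A ∷ As)) (proj₁ a , Fin.suc (proj₂ a)) (proj₁ b , Fin.suc (proj₂ b)) ]
        weight (ω (A ∷ As)) w′ ≡ weight (ω As) w
    shift Star.ε         = Star.ε , refl
    shift (step {i} {j} l e ◅ w) with w′ , eq ← shift w =
      step (Fin.suc l) e ◅ w′ , cong (lookup As l i j ⊗_) eq

    unshift : ∀ {a b} (w : Star (Edge (A ∷ As)) a b) → ∀ {x} → proj₂ a ≡ Fin.suc x →
      ∃ λ y → proj₂ b ≡ Fin.suc y × Σ[ w′ ∈ Star (Edge As) (proj₁ a , x) (proj₁ b , y) ]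
        weight (ω As) w′ ≡ weight (ω (A ∷ As)) w
    unshift Star.ε eq = _ , eq , Star.ε , refl
    unshift (step {i} {j} (Fin.suc l) e ◅ w) refl with y , eq , w′ , weight≡ ← unshift w refl =
      y , eq , step l e ◅ w′ , cong (lookup As l i j ⊗_) weight≡

  open Trellis using (Edge; ω; step)

  I-diagonal : ∀ i → I {n} i i ≡ [ 0# ]
  I-diagonal i with i Fin.≟ i
  ... | yes _  = refl
  ... | no i≢i = contradiction refl i≢i

  I-finite : ∀ {i j a} → I {n} i j ≡ [ a ] → i ≡ j × a ≡ 0#
  I-finite {i} {j} eq with i Fin.≟ j
  I-finite refl | yes i≡j = i≡j , refl

  -- Together with `prod-attained` this makes each entry of the product the optimal weight of a
  -- trellis walk across all levels. The end levels are given by equations since `inject₁ l` in the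
  -- type of `step` cannot be unified with a fixed level.
  weight≤prod : ∀ {k} (As : Vec (Matrix n) k) {a b} (w : Star (Edge As) a b) →
    proj₂ a ≡ Fin.zero → proj₂ b ≡ fromℕ k → weight (ω As) w ≤₋ prod As (proj₁ a) (proj₁ b)
  weight≤prod []       {a} Star.ε  _ _ = ≤₋-reflexive (≈₋.reflexive (sym (I-diagonal (proj₁ a))))
  weight≤prod []       (step () _ ◅ _) _ _
  weight≤prod (A ∷ As) Star.ε eq eq′ with () ← trans (sym eq) eq′
  weight≤prod (A ∷ As) {b = b} (step {i} {j} Fin.zero e ◅ w) refl b≡k
    with y , b≡1+y , w′ , weight≡ ← unshift A As w refl
    = ≤₋-trans (⊗-mono ≤₋-refl (subst (_≤₋ prod As j (proj₁ b)) weight≡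
        (weight≤prod As w′ refl (Fin.suc-injective (trans (sym b≡1+y) b≡k)))))
      (⊠-≥ A (prod As) i j (proj₁ b))

  prod-attained : ∀ {k} (As : Vec (Matrix n) k) → (∀ l → 𝒴 (lookup As l)) → ∀ {i j a} →
    prod As i j ≡ [ a ] → Σ[ w ∈ Star (Edge As) (i , Fin.zero) (j , fromℕ k) ] weight (ω As) w ≡ [ a ]
  prod-attained []       _   {i} {j} eq with refl , refl ← I-finite {i} {j} eq = Star.ε , refl
  prod-attained (A ∷ As) As∈𝒴 {i} {j} eq
    with h , b , c , Aih≡b , prod≡c , refl ← ⊠-attained A (prod As) {i} {j} eq
    with w , weight≡ ← prod-attained As (λ l → As∈𝒴 (Fin.suc l)) prod≡c
    with w′ , weight≡′ ← shift A As w
    = step Fin.zero (𝒴-finite⇒E (As∈𝒴 Fin.zero) Aih≡b) ◅ w′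
    , ≡.cong₂ _⊗_ Aih≡b (trans weight≡′ weight≡)

  module _ {k : ℕ} (As : Vec (Matrix n) k) (As∈𝒴 : ∀ l → 𝒴 (lookup As l)) where

    ω≤0 : ∀ {a b} (e : Edge As a b) → ω As e ≤₋ [ 0# ]
    ω≤0 (step {i} {j} l _) = ≤₋-trans (𝒴≤Aˢᵘᵖ (As∈𝒴 l) i j) (Aˢᵘᵖ≤0 i j)

    -- Critical entries are 0 in every matrix of `𝒴`, so a critical walk can be placed between any
    -- two levels at the right distance, at no cost.
    climb : ∀ {l a b} → Walk 𝓔c l a b → ∀ x y → toℕ x ℕ.+ l ≡ toℕ y →
            Σ[ w ∈ Star (Edge As) (a , x) (b , y) ] weight (ω As) w ≈₋ [ 0# ]
    climb [] x y eq with refl ← toℕ-injective {i = x} {y} (trans (sym (ℕ.+-identityʳ _)) eq) =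
      Star.ε , ≈₋.refl
    -- An edge is left to place, so `x` lies below the top level and can be written as `inject₁ x′`,
    -- as `step` demands.
    climb {suc l} {a} (_∷_ {h = h} c w) x y eq = go (Fin.lower₁ x x≢k) (Fin.inject₁-lower₁ x x≢k)
      where
      x<k : toℕ x ℕ.< k
      x<k = ℕ.<-≤-trans (ℕ.m<m+n (toℕ x) (ℕ.s≤s ℕ.z≤n)) (ℕ.≤-trans (ℕ.≤-reflexive eq) (ℕ.≤-pred (toℕ<n y)))
      x≢k : k ≢ toℕ x
      x≢k k≡x = ℕ.<-irrefl (sym k≡x) x<k
      go : ∀ x′ → inject₁ x′ ≡ x → Σ[ w ∈ Star (Edge As) (a , x) (_ , y) ] weight (ω As) w ≈₋ [ 0# ]
      go x′ refl with w′ , weight≈ ← climb w (Fin.suc x′) y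
                        (trans (sym (trans (ℕ.+-suc _ l) (cong (λ x → suc (x ℕ.+ l)) (toℕ-inject₁ x′)))) eq)
        = step x′ (𝓔c⇒E c) ◅ w′
        , ≈₋.trans (⊗-cong (critical≈0 (lookup As x′) (As∈𝒴 x′) a h c) weight≈) (⊗-identityˡ _)

    -- Forgetting levels can only raise the weight, as `Aˢᵘᵖ` dominates `𝒴`. Sources and targets are
    -- tracked in order to carry over the avoidance of `𝓝c`.
    toAˢᵘᵖ : ∀ {a b} (w : Star (Edge As) a b) → Σ[ w′ ∈ Star (𝒟 Aˢᵘᵖ) (proj₁ a) (proj₁ b) ]
      length w′ ≡ length w × sources w′ ≡ List.map proj₁ (sources w) ×
      targets w′ ≡ List.map proj₁ (targets w) × weight (ω As) w ≤₋ weightᵐ Aˢᵘᵖ w′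
    toAˢᵘᵖ Star.ε = Star.ε , refl , refl , refl , ≤₋-refl
    toAˢᵘᵖ (step {i} {j} l e ◅ w) with w′ , len , src , tgt , weight≤ ← toAˢᵘᵖ w =
      Equivalence.to (digraphˢᵘᵖ i j) e ◅ w′ , cong suc len , cong (_ ∷_) src , cong (_ ∷_) tgt ,
      ⊗-mono (𝒴≤Aˢᵘᵖ (As∈𝒴 l) i j) weight≤

  -- χ, read modulo γ, numbers the cyclic classes of D(𝒳).
  module Classes {γ : ℕ} (cyclicity : IsCyclicity E γ) (o : Fin n) where

    open Congruence γ

    χ : Fin n → ℕ
    χ i = length (E-connected o i)

    private
      closed~0 : ∀ {v} (c : Star E v v) → length c ~ 0
      closed~0 Star.ε    = ~-reflexive refl
      closed~0 c@(_ ◅ _) = ∣⇒~0 (proj₁ cyclicity c (ℕ.s≤s ℕ.z≤n))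

    -- The chosen walk from `o` to `j`, and the one through `i` and the edge, become closed when
    -- followed by the same walk back to `o`; `γ` divides both closed lengths.
    χ-edge : ∀ {i j} → E i j → χ j ~ χ i ℕ.+ 1
    χ-edge {i} {j} e = ~-cancelʳ (length back) (~-trans (closed (E-connected o j)) (~-sym
      (~-trans (~-reflexive (cong (ℕ._+ length back) (sym (length-◅◅ (E-connected o i) (e ◅ Star.ε)))))
               (closed (E-connected o i ◅◅ e ◅ Star.ε)))))
      where
      back = E-connected j o
      closed : (w : Star E o j) → length w ℕ.+ length back ~ 0
      closed w = ~-trans (~-reflexive (sym (length-◅◅ w back))) (closed~0 (w ◅◅ back))

    trellis-class : ∀ {k} (As : Vec (Matrix n) k) {a b} (w : Star (Edge As) a b) →
                    χ (proj₁ b) ~ χ (proj₁ a) ℕ.+ length w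
    trellis-class As w = potential χ χ-edge (toWalkᴱ As w)

    prod-class : ∀ {k} (As : Vec (Matrix n) k) → (∀ l → 𝒴 (lookup As l)) → ∀ {i j x} →
                 prod As i j ≡ [ x ] → χ j ~ χ i ℕ.+ k
    prod-class {k} As As∈𝒴 {i} eq with w , _ ← prod-attained As As∈𝒴 eq =
      ~-trans (trellis-class As w)
        (~-reflexive (cong (χ i ℕ.+_) (trans (level-length As w) (toℕ-fromℕ k))))

-- Powers of `S` as walks on the critical digraph.

module CriticalPowers (ℛ : Reals) {p : Level} {n : ℕ} {𝒳 : Pred (Tropical.Matrix ℛ n) p}
  (setting : Tropical.Setting ℛ 𝒳) where

  open Tropical ℛ
  open OrderedField ℛ using (≤-reflexive; module Eq; +-mono-≤; +-identityˡ; ≤-respʳ-≈; ≤-refl)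
  open MaxPlus ℛ
  open Setting setting
  open Setup ℛ setting

  private
    S-critical : ∀ {i j} → 𝓔c i j → S i j ≡ [ 0# ]
    S-critical {i} {j} c with i 𝓔c? j
    ... | yes _ = refl
    ... | no ¬c = contradiction c ¬c

    S-finite : ∀ {i j a} → S i j ≡ [ a ] → 𝓔c i j × a ≡ 0#
    S-finite {i} {j} eq with i 𝓔c? j
    S-finite refl | yes c = c , refl

  S^-finite : ∀ l {i j a} → (S ^ᵐ l) i j ≡ [ a ] → Walk 𝓔c l i j × a ≤ 0#
  S^-finite zero    {i} {j} eq with refl , refl ← I-finite {i} {j} eq = [] , ≤-refl
  S^-finite (suc l) {i} {j} eq with h , b , c , Sih , rest , refl ← ⊠-attained S (S ^ᵐ l) {i} {j} eq
    with e , refl ← S-finite Sih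
    with w , c≤0 ← S^-finite l rest = e ∷ w , ≤-respʳ-≈ (+-identityˡ 0#) (+-mono-≤ ≤-refl c≤0)

  0≤S^ : ∀ {l i j} → Walk 𝓔c l i j → [ 0# ] ≤₋ (S ^ᵐ l) i j
  0≤S^ {i = i} [] = ≤₋-reflexive (≈₋.reflexive (sym (I-diagonal i)))
  0≤S^ {suc l} {i} {j} (_∷_ {h = h} c w) = ≤₋-trans
    (≤₋-reflexive (≈₋.trans (≈₋.sym (⊗-identityˡ [ 0# ]))
      (⊗-cong (≈₋.reflexive (sym (S-critical c))) ≈₋.refl)))
    (≤₋-trans (⊗-mono (≤₋-refl {S i h}) (0≤S^ w)) (⊠-≥ S (S ^ᵐ l) i h j))

  module _ {γ T : ℕ} (transient : IsTransient S γ T) where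

    private
      periodic : ∀ z {l} → T ℕ.≤ l → S ^ᵐ (l ℕ.+ z ℕ.* γ) ≋ S ^ᵐ l
      periodic zero    {l} T≤l i j = ≈₋.reflexive (cong (λ l → (S ^ᵐ l) i j) (ℕ.+-identityʳ l))
      periodic (suc z) {l} T≤l i j = ≈₋.trans
        (≈₋.reflexive (cong (λ l → (S ^ᵐ l) i j)
          (trans (cong (l ℕ.+_) (ℕ.+-comm γ (z ℕ.* γ))) (sym (ℕ.+-assoc l (z ℕ.* γ) γ)))))
        (≈₋.trans (proj₁ transient _ (ℕ.≤-trans T≤l (ℕ.m≤m+n l _)) i j) (periodic z T≤l i j))

    -- Periodicity of the powers of `S`, read as a statement about walks: finite entries are exactly
    -- walks of that length.
    shorten-critical : ∀ {z l i j} → T ℕ.≤ l → Walk 𝓔c (l ℕ.+ z ℕ.* γ) i j → Walk 𝓔c l i j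
    shorten-critical {z} {l} {i} {j} T≤l w
      with a , eq ← finite-≤ (≤₋-trans (0≤S^ w) (≤₋-reflexive (periodic z T≤l i j)))
      = proj₁ (S^-finite l eq)

  module Critical {γ : ℕ} .{{_ : NonZero γ}} (cyclicity : IsCyclicity E γ) (o : Fin n)
    (connected : StronglyConnected (_∈ 𝓝c) 𝓔c) where

    open Congruence γ
    open Classes cyclicity o

    𝓔c-class : ∀ {l i j} → Walk 𝓔c l i j → χ j ~ χ i ℕ.+ l
    𝓔c-class = potential χ (λ c → χ-edge (𝓔c⇒E c))

    circuit : ∀ {i} → i ∈ 𝓝c → ∃ λ l → Walk 𝓔c (suc l) i i
    circuit i∈ with j , c ← successor i∈ =
      _ , c ∷ toWalk (λ c → c) (connected (proj₂ (𝓔c-nodes c)) i∈)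

    outgoing : ∀ l {i} → i ∈ 𝓝c → ∃ λ j → Walk 𝓔c l i j
    outgoing l {i} i∈ with m , c ← circuit i∈
      with f , eq ← ℕ.m≤n⇒∃[o]m+o≡n (ℕ.m≤m*n l (suc m))
      with j , w , _ ← split l (subst (λ l → Walk 𝓔c l i i) (sym eq) (iterate l c)) = j , w

    incoming : ∀ l {i} → i ∈ 𝓝c → ∃ λ j → j ∈ 𝓝c × Walk 𝓔c l j i
    incoming l {i} i∈ with m , c ← circuit i∈
      with f , eq ← ℕ.m≤n⇒∃[o]m+o≡n (ℕ.m≤m*n l (suc m))
      with j , w′ , w ← split f (subst (λ l → Walk 𝓔c l i i) (trans (sym eq) (ℕ.+-comm l f)) (iterate l c))
      = j , 𝓔c-walk-end i∈ w′ , w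

    module _ {T : ℕ} (transient : IsTransient S γ T) where

      -- Any critical walk from `i` to `j`, followed by `l` turns round a circuit at `j`, has length
      -- at least `l`. Its classes make the excess a multiple of `γ`, which `shorten-critical`
      -- removes.
      critical-walk : ∀ {i j} l → i ∈ 𝓝c → j ∈ 𝓝c → T ℕ.≤ l → χ j ~ χ i ℕ.+ l → Walk 𝓔c l i j
      critical-walk {i} {j} l i∈ j∈ T≤l i→j = result
        where
        w = toWalk (λ c → c) (connected i∈ j∈)
        m = proj₁ (circuit j∈)
        l₀ = length (connected i∈ j∈)
        l′ = l₀ ℕ.+ l ℕ.* suc m
        w′ : Walk 𝓔c l′ i j
        w′ = w ++ iterate l (proj₂ (circuit j∈))
        l~l′ : l ~ l′
        l~l′ = ~-cancelʳ (χ i) (~-trans (~-reflexive (ℕ.+-comm l (χ i)))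
          (~-trans (~-sym i→j) (~-trans (𝓔c-class w′) (~-reflexive (ℕ.+-comm (χ i) l′)))))
        l≤l′ : l ℕ.≤ l′
        l≤l′ = ℕ.≤-trans (ℕ.m≤m*n l (suc m)) (ℕ.m≤n+m _ l₀)
        result : Walk 𝓔c l i j
        result = let z , eq = ~⇒+* l~l′ l≤l′ in
          shorten-critical {γ} transient {z} T≤l (subst (λ l → Walk 𝓔c l i j) eq w′)

      -- A walk to be pulled back along the enumeration of 𝓝c must be nonempty, hence suc T.
      critical-walk-Sch : ∀ {i j} l → i ∈ 𝓝c → j ∈ 𝓝c → Sch γ q ℕ.≤ l → χ j ~ χ i ℕ.+ l → Walk 𝓔c l i j
      critical-walk-Sch l i∈ j∈ Sch≤l i→j
        with e , e∈ , onto ← enumeration 𝓝c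
        with s , refl ← onto i∈
        with t , refl ← onto j∈
        = pushforward e (schwarz {T = suc T} (λ s → χ (e s)) (λ c → χ-edge (𝓔c⇒E c))
            (λ { (suc l) s t (ℕ.s≤s T≤l) s→t → pullback e (λ c → onto (proj₂ (𝓔c-nodes c)))
                   (critical-walk (suc l) (e∈ s) (e∈ t) (ℕ.m≤n⇒m≤1+n T≤l) s→t) })
            l s t Sch≤l i→j)

-- Length bounds for walks that avoid critical nodes.

module Noncritical (ℛ : Reals) {p : Level} {n : ℕ} {𝒳 : Pred (Tropical.Matrix ℛ n) p}
  (setting : Tropical.Setting ℛ 𝒳) where

  open Tropical ℛ
  open OrderedField ℛ
  open MaxPlus ℛ
  open WeightedDigraph ℛ
  open Setting setting
  open Setup ℛ setting

  private
    Bˢᵘᵖ≡Aˢᵘᵖ : ∀ {i j} → i ∉ 𝓝c → j ∉ 𝓝c → Bˢᵘᵖ i j ≡ Aˢᵘᵖ i j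
    Bˢᵘᵖ≡Aˢᵘᵖ {i} {j} i∉ j∉ with i ∈? 𝓝c | j ∈? 𝓝c
    ... | no _   | no _   = refl
    ... | yes i∈ | _      = contradiction i∈ i∉
    ... | no _   | yes j∈ = contradiction j∈ j∉

    Bˢᵘᵖ-finite : ∀ {i j} → 𝒟 Bˢᵘᵖ i j → i ∉ 𝓝c × Bˢᵘᵖ i j ≡ Aˢᵘᵖ i j
    Bˢᵘᵖ-finite {i} {j} B≢ε with i ∈? 𝓝c | j ∈? 𝓝c
    ... | no i∉ | no _  = i∉ , refl
    ... | yes _ | _     = contradiction refl B≢ε
    ... | no _  | yes _ = contradiction refl B≢ε

    toBˢᵘᵖ : ∀ {u v} (w : Star (𝒟 Aˢᵘᵖ) u v) → All (_∉ 𝓝c) (nodes w) →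
      Σ[ w′ ∈ Star (𝒟 Bˢᵘᵖ) u v ] length w′ ≡ length w × weightᵐ Bˢᵘᵖ w′ ≡ weightᵐ Aˢᵘᵖ w
    toBˢᵘᵖ Star.ε _ = Star.ε , refl , refl
    toBˢᵘᵖ (e ◅ w) (u∉ ∷ w∉@(x∉ ∷ _)) with w′ , len , weight≡ ← toBˢᵘᵖ w w∉ =
      (λ B≡ε → e (trans (sym (Bˢᵘᵖ≡Aˢᵘᵖ u∉ x∉)) B≡ε)) ◅ w′ , cong suc len ,
      ≡.cong₂ _⊗_ (Bˢᵘᵖ≡Aˢᵘᵖ u∉ x∉) weight≡

    fromBˢᵘᵖ : ∀ {u v} (w : Star (𝒟 Bˢᵘᵖ) u v) →
      Σ[ w′ ∈ Star (𝒟 Aˢᵘᵖ) u v ] length w′ ≡ length w × weightᵐ Aˢᵘᵖ w′ ≡ weightᵐ Bˢᵘᵖ w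
    fromBˢᵘᵖ Star.ε = Star.ε , refl , refl
    fromBˢᵘᵖ (e ◅ w) with w′ , len , weight≡ ← fromBˢᵘᵖ w | _ , B≡A ← Bˢᵘᵖ-finite e =
      (λ A≡ε → e (trans B≡A A≡ε)) ◅ w′ , cong suc len , ≡.cong₂ _⊗_ (sym B≡A) weight≡

    mean≤0 : ∀ {v} (c : Star (𝒟 Aˢᵘᵖ) v v) → IsCycle c → mean Aˢᵘᵖ c ≤₋ [ 0# ]
    mean≤0 c cycle with weightᵐ Aˢᵘᵖ c | weight≤0 (λ {i} {j} _ → Aˢᵘᵖ i j) (λ {i} {j} _ → Aˢᵘᵖ≤0 i j) c
    ... | ⊥₋    | _     = ⊥₋≤ _
    ... | [ x ] | [ x≤0 ] = [ ≤-respʳ-≈ (zeroˡ _)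
      (*-monoʳ-≤ _ (0≤⁻¹ (0≤fromNat (length c)) (fromNat≉0 cycle)) x≤0) ]

    power-finite : ∀ μ d → power [ μ ] d ≈₋ [ μ * fromNat d ]
    power-finite μ zero    = [ Eq.sym (zeroʳ μ) ]
    power-finite μ (suc d) = ≈₋.trans (⊗-cong ≈₋.refl (power-finite μ d))
      [ Eq.trans (+-congʳ (Eq.sym (*-identityʳ μ))) (Eq.sym (distribˡ μ 1# (fromNat d))) ]

  -- Real-valued counterpart of `_⟋_` for finite numerators, with the same value 0 for the
  -- denominator `ε`.
  ratio : ℝmax → Carrier → Carrier
  ratio ⊥₋    x = 0#
  ratio [ μ ] x = x / μ

  ratio-+ : ∀ λ* x y → ratio λ* x + ratio λ* y ≈ ratio λ* (x + y)
  ratio-+ ⊥₋    x y = +-identityˡ 0#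
  ratio-+ [ μ ] x y = Eq.sym (distribʳ (μ ⁻¹) x y)

  ratio-cong : ∀ λ* {x y} → x ≈ y → ratio λ* x ≈ ratio λ* y
  ratio-cong ⊥₋    _   = Eq.refl
  ratio-cong [ μ ] x≈y = *-congʳ x≈y

  module Bounds (λ* : ℝmax) (maxMean : IsMaxCycleMean Bˢᵘᵖ λ*) where

    -- Such a cycle lies in `Bˢᵘᵖ`, so its mean is at most `λ*`.
    cycle≤power : ∀ {v} (c : Star (𝒟 Aˢᵘᵖ) v v) → IsCycle c → All (_∉ 𝓝c) (sources c) →
                  weightᵐ Aˢᵘᵖ c ≤₋ power λ* (length c)
    cycle≤power {v} c cycle sources∉ = scale (weightᵐ Aˢᵘᵖ c) λ* (proj₁ maxMean _ (v , c′
      , subst (1 ℕ.≤_) (sym len) cycle , ≈₋.reflexive (≡.cong₂ _÷_ weight≡ len)))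
      where
      avoids : All (_∉ 𝓝c) (nodes c)
      avoids = All-nodes c sources∉ (head c cycle sources∉)
        where
        head : (c : Star (𝒟 Aˢᵘᵖ) v v) → IsCycle c → All (_∉ 𝓝c) (sources c) → v ∉ 𝓝c
        head (_ ◅ _) _ (v∉ ∷ _) = v∉
      c′ = proj₁ (toBˢᵘᵖ c avoids)
      len = proj₁ (proj₂ (toBˢᵘᵖ c avoids))
      weight≡ = proj₂ (proj₂ (toBˢᵘᵖ c avoids))
      scale : ∀ x μ → x ÷ length c ≤₋ μ → x ≤₋ power μ (length c)
      scale ⊥₋    μ     _     = ⊥₋≤ _
      scale [ x ] [ μ ] [ p ] = ≤₋-trans
        [ ≤-respˡ-≈ (x/y*y≈x x (fromNat≉0 cycle)) (*-monoʳ-≤ _ (0≤fromNat (length c)) p) ]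
        (≤₋-reflexive (≈₋.sym (power-finite μ (length c))))

    -- A cycle of mean weight 0 would be critical.
    negative : ∀ {μ} → λ* ≡ [ μ ] → μ ≤ 0# × ¬ μ ≈ 0#
    negative {μ} refl with proj₂ maxMean
    ... | inj₁ (v , c , cycle , mean≈μ) =
      unpack (≤₋-trans (≤₋-reflexive (≈₋.sym mean≈μ′)) (mean≤0 c′ cycle′)) , nonzero
      where
      unpack : ∀ {a b} → [ a ] ≤₋ [ b ] → a ≤ b
      unpack [ p ] = p
      c′ = proj₁ (fromBˢᵘᵖ c)
      len = proj₁ (proj₂ (fromBˢᵘᵖ c))
      cycle′ : IsCycle c′
      cycle′ = subst (1 ℕ.≤_) (sym len) cycle
      mean≈μ′ : mean Aˢᵘᵖ c′ ≈₋ [ μ ]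
      mean≈μ′ = ≈₋.trans (≈₋.reflexive (≡.cong₂ _÷_ (proj₂ (proj₂ (fromBˢᵘᵖ c))) len)) mean≈μ
      head : (c : Star (𝒟 Bˢᵘᵖ) v v) → IsCycle c → v ∉ 𝓝c
      head (e ◅ _) _ = proj₁ (Bˢᵘᵖ-finite e)
      nonzero : ¬ μ ≈ 0#
      nonzero μ≈0 = head c cycle (Equivalence.from (critNodesˢᵘᵖ v) (v , c′ , (cycle′ ,
        (λ { x (_ , d , dcycle , mean≈x) → ≤₋-trans (≤₋-reflexive (≈₋.sym mean≈x)) (≤₋-trans (mean≤0 d dcycle)
               (≤₋-reflexive (≈₋.trans [ Eq.sym μ≈0 ] (≈₋.sym mean≈μ′)))) })
        , inj₁ (v , c′ , cycle′ , ≈₋.refl)) , here refl))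

    -- From `W ≤ a + d λ*` with `λ*` negative, division gives `d ≤ (W - a) / λ*`. If `λ*` is `ε`,
    -- finiteness of `W` forces `d = 0`.
    excess : ∀ {W P a d} → [ W ] ≤₋ P ⊗ power λ* d → P ≤₋ [ a ] → fromNat d ≤ ratio λ* (W - a)
    excess {W} {P} {a} {d} W≤ P≤a = go λ* d refl W≤ P≤a
      where
      go : ∀ {P} μ d → λ* ≡ μ → [ W ] ≤₋ P ⊗ power μ d → P ≤₋ [ a ] → fromNat d ≤ ratio μ (W - a)
      go         ⊥₋    zero    _  _  _ = ≤-refl
      go {⊥₋}    ⊥₋    (suc d) _  () _
      go {[ _ ]} ⊥₋    (suc d) _  () _
      go         [ μ ] d       eq W≤ P≤a with ≤₋-trans W≤ (⊗-mono P≤a (≤₋-reflexive (power-finite μ d)))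
      ... | [ p ] = let μ≤0 , μ≉0 = negative eq in
        ≤-respˡ-≈ (Eq.trans (*-congʳ (*-comm μ (fromNat d))) (x*y/y≈x (fromNat d) μ≉0))
          (*-antiʳ-≤ (μ ⁻¹) (⁻¹≤0 μ≤0 μ≉0)
            (+-cancelʳ-≤ a (≤-respˡ-≈ (Eq.sym (x-y+y≈x W a)) (≤-respʳ-≈ (+-comm a _) p))))

    length-bound : ∀ {L ℓ N d W P a} → L ≡ ℓ ℕ.+ d → ℓ ℕ.≤ N → [ W ] ≤₋ P ⊗ power λ* d → P ≤₋ [ a ] →
                   fromNat L ≤ fromNat N + ratio λ* (W - a)
    length-bound {ℓ = ℓ} {d = d} refl ℓ≤N W≤ P≤a = ≤-respˡ-≈ (Eq.sym (fromNat-+ ℓ d))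
      (+-mono-≤ (fromNat-mono-≤ ℓ≤N) (excess {d = d} W≤ P≤a))

    private
      erase : ∀ {u v} (w : Star (𝒟 Aˢᵘᵖ) u v) → All (_∉ 𝓝c) (sources w) →
        Σ[ w′ ∈ Star (𝒟 Aˢᵘᵖ) u v ] IsPath w′ × All (_∉ 𝓝c) (sources w′) ×
          ∃ λ d → length w ≡ length w′ ℕ.+ d × weightᵐ Aˢᵘᵖ w ≤₋ weightᵐ Aˢᵘᵖ w′ ⊗ power λ* d
      erase = erase-cycles (λ {i} {j} _ → Aˢᵘᵖ i j) {x = λ*} Fin._≟_ cycle≤power

      -- The first edge is protected from erasure in two cases: when it leaves a critical node, and
      -- when the walk is closed, where full erasure would leave the empty path instead of a cycle.
      -- The length of `e ◅ w′` equals the number of nodes of `w′`, all distinct and noncritical,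
      -- hence `n ∸ q`.
      erase-tail : ∀ {u x v} (e : 𝒟 Aˢᵘᵖ u x) (w : Star (𝒟 Aˢᵘᵖ) x v) → All (_∉ 𝓝c) (nodes w) →
        Σ[ w′ ∈ Star (𝒟 Aˢᵘᵖ) x v ] IsPath w′ × All (_∉ 𝓝c) (nodes w′) × length (e ◅ w′) ℕ.≤ n ∸ q ×
          ∃ λ d → length (e ◅ w) ≡ length (e ◅ w′) ℕ.+ d ×
            weightᵐ Aˢᵘᵖ (e ◅ w) ≤₋ weightᵐ Aˢᵘᵖ (e ◅ w′) ⊗ power λ* d
      erase-tail e w w∉ with w′ , path , sources∉ , d , len , weight≤ ← erase w (All-sources w w∉) =
        let w′∉ = All-nodes w′ sources∉ (All-last w w∉) in
        w′ , path , w′∉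
        , subst (ℕ._≤ n ∸ q) (cong suc (length-targets w′)) (unique-length-∁ 𝓝c path w′∉)
        , d , cong suc len
        , ≤₋-trans (⊗-mono ≤₋-refl weight≤) (≤₋-reflexive (≈₋.sym (⊗-assoc _ (weightᵐ Aˢᵘᵖ w′) _)))

    module _ {k : ℕ} (As : Vec (Matrix n) k) (As∈𝒴 : ∀ l → 𝒴 (lookup As l)) where

      open Trellis As

      -- Erasing cycles from an optimal walk leaves a path to `𝓝c` of weight at most `α`, with at
      -- most `n ∸ q` edges since its sources are distinct and noncritical; `excess` bounds the
      -- number of erased edges.
      w*-walk : ∀ {i a α} → IsW* i [ a ] → IsAlpha i [ α ] →
        ∃₂ λ j m → Σ[ w ∈ Star Edge (i , Fin.zero) (j , m) ] j ∈ 𝓝c × weight ω w ≈₋ [ a ] ×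
          fromNat (length w) ≤ fromNat (n ∸ q) + ratio λ* (a - α)
      w*-walk (_ , inj₁ (j , m , w , j∈ , w∉ , weight≈)) (α-max , _)
        with w₁ , len₁ , src , _ , weight≤₁ ← toAˢᵘᵖ As As∈𝒴 w
        with w₂ , path , w₂∉ , d , len₂ , weight≤₂ ← erase w₁ (subst (All (_∉ 𝓝c)) (sym src) (All.map⁺ w∉))
        = j , m , w , j∈ , weight≈ , length-bound {d = d} (trans (sym len₁) len₂)
            (subst (ℕ._≤ n ∸ q) (length-sources w₂) (unique-length-∁ 𝓝c (unique-sources w₂ path) w₂∉))
            (≤₋-trans (≤₋-reflexive (≈₋.sym weight≈)) (≤₋-trans weight≤₁ weight≤₂))
            (α-max _ (j , w₂ , j∈ , path , ≈₋.refl))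

      v*-walk : ∀ {j a β} → IsV* j [ a ] → IsBeta j [ β ] →
        ∃₂ λ i l → Σ[ w ∈ Star Edge (i , l) (j , fromℕ k) ] i ∈ 𝓝c × weight ω w ≈₋ [ a ] ×
          fromNat (length w) ≤ fromNat (n ∸ q) + ratio λ* (a - β)
      v*-walk {j} {a} {β} (_ , inj₁ (i , l , w , i∈ , w∉ , weight≈)) (β-max , _)
        with w₁ , len₁ , _ , tgt , weight≤₁ ← toAˢᵘᵖ As As∈𝒴 w
        = i , l , w , i∈ , weight≈ , subst (λ l → fromNat l ≤ fromNat (n ∸ q) + ratio λ* (a - β)) len₁
            (bound w₁ (subst (All (_∉ 𝓝c)) (sym tgt) (All.map⁺ w∉))
              (≤₋-trans (≤₋-reflexive (≈₋.sym weight≈)) weight≤₁))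
        where
        bound : (w : Star (𝒟 Aˢᵘᵖ) i j) → All (_∉ 𝓝c) (targets w) → [ a ] ≤₋ weightᵐ Aˢᵘᵖ w →
                fromNat (length w) ≤ fromNat (n ∸ q) + ratio λ* (a - β)
        -- There is no edge to set aside; the empty path shows `β` to be at least 0.
        bound Star.ε _ a≤ = length-bound {N = n ∸ q} {d = 0} refl ℕ.z≤n
          (≤₋-trans a≤ (≤₋-reflexive (≈₋.sym (⊗-identityʳ [ 0# ]))))
          (β-max _ (i , Star.ε , i∈ , [] ∷ [] , ≈₋.refl))
        bound (e ◅ w) w∉ a≤ with w′ , path , w′∉ , short , d , len , weight≤ ← erase-tail e w w∉ =
          length-bound {d = d} len short (≤₋-trans a≤ weight≤)
            (β-max _ (i , e ◅ w′ , i∈ , All.map (λ y∉ i≡y → y∉ (subst (_∈ 𝓝c) i≡y i∈)) w′∉ ∷ path , ≈₋.refl))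

      -- What remains after erasure is a path or, for `i = j`, a cycle through `i`, so `g` is finite
      -- and the pair `(i , j)` does occur in the second maximum. `1 ≤ k` excludes the empty walk,
      -- which is no cycle.
      avoiding-walk : ∀ {i j a g} (w : Star Edge (i , Fin.zero) (j , fromℕ k)) → 1 ℕ.≤ k →
        All (λ y → proj₁ y ∉ 𝓝c) (nodes w) → [ a ] ≤₋ weight ω w → IsGamma i j g →
        ∃ λ g′ → g ≡ [ g′ ] × fromNat k ≤ fromNat (n ∸ q) + ratio λ* (a - g′)
      avoiding-walk {i} {j} {a} {g} w 1≤k w∉ a≤ (γ-max , _)
        with w₁ , len₁ , _ , tgt , weight≤₁ ← toAˢᵘᵖ As As∈𝒴 w
        = bound w₁ len (subst (λ ts → All (_∉ 𝓝c) (i ∷ ts)) (sym tgt) (All.map⁺ w∉)) (≤₋-trans a≤ weight≤₁)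
        where
        len : length w₁ ≡ k
        len = trans len₁ (trans (level-length As w) (toℕ-fromℕ k))
        bound : (w : Star (𝒟 Aˢᵘᵖ) i j) → length w ≡ k → All (_∉ 𝓝c) (nodes w) → [ a ] ≤₋ weightᵐ Aˢᵘᵖ w →
                ∃ λ g′ → g ≡ [ g′ ] × fromNat k ≤ fromNat (n ∸ q) + ratio λ* (a - g′)
        finish : ∀ {P d ℓ} → P ≤₋ g → k ≡ ℓ ℕ.+ d → ℓ ℕ.≤ n ∸ q → [ a ] ≤₋ P ⊗ power λ* d →
                 ∃ λ g′ → g ≡ [ g′ ] × fromNat k ≤ fromNat (n ∸ q) + ratio λ* (a - g′)
        finish         (⊥₋≤ _) _  _     ()
        finish {d = d} [ P≤g ] eq short a≤ = _ , refl , length-bound {d = d} eq short a≤ [ P≤g ]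

        bound Star.ε eq _ _ = contradiction (subst (1 ℕ.≤_) (sym eq) 1≤k) λ ()
        bound (e ◅ w) eq (i∉ ∷ w∉) a≤ with i Fin.≟ j
        ... | yes refl =
          let w′ , path , w′∉ , short , d , len , weight≤ = erase-tail e w w∉ in
          finish {d = d} (γ-max _ (inj₂ (refl , i , e ◅ w′ , ℕ.s≤s ℕ.z≤n , here refl , i∉ ∷ w′∉ , ≈₋.refl)))
            (trans (sym eq) len) short (≤₋-trans a≤ weight≤)
        ... | no i≢j =
          let w′ , path , sources∉ , d , len , weight≤ = erase (e ◅ w) (i∉ ∷ All-sources w w∉) in
          finish {d = d} (γ-max _ (inj₁ (i≢j , w′ , path , All-nodes w′ sources∉ (All-last w w∉) , ≈₋.refl)))
            (trans (sym eq) len)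
            (subst (ℕ._≤ n ∸ q) (length-sources w′)
              (unique-length-∁ 𝓝c (unique-sources w′ path) sources∉))
            (≤₋-trans a≤ weight≤)

-- The entries of CSR in terms of u*.

module Expansion (ℛ : Reals) {p : Level} {n : ℕ} {𝒳 : Pred (Tropical.Matrix ℛ n) p}
  (setting : Tropical.Setting ℛ 𝒳) where

  open Tropical ℛ
  open OrderedField ℛ
  open MaxPlus ℛ
  open WeightedDigraph ℛ
  open Setting setting
  open Setup ℛ setting
  open CriticalPowers ℛ setting
  open Noncritical ℛ setting

  private
    ⊗≤⊠-sandwich : ∀ (G P Q : Matrix n) {i c h h′ d j} →
      [ 0# ] ≤₋ P c h → [ 0# ] ≤₋ Q h h′ → [ 0# ] ≤₋ P h′ d →
      G i c ⊗ G d j ≤₋ (G ⊠ P ⊠ Q ⊠ (P ⊠ G)) i j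
    ⊗≤⊠-sandwich G P Q {i} {c} {h} {h′} {d} {j} p₁ p₂ p₃ = begin
      G i c ⊗ G d j
        ≈⟨ ⊗-cong (≈₋.trans (⊗-identityʳ _) (⊗-identityʳ (G i c))) (⊗-identityˡ (G d j)) ⟨
      G i c ⊗ [ 0# ] ⊗ [ 0# ] ⊗ ([ 0# ] ⊗ G d j)
        ≤⟨ ⊗-mono (⊗-mono (⊗-mono (≤₋-refl {G i c}) p₁) p₂) (⊗-mono p₃ (≤₋-refl {G d j})) ⟩
      G i c ⊗ P c h ⊗ Q h h′ ⊗ (P h′ d ⊗ G d j)
        ≤⟨ ⊗-mono (≤₋-trans (⊗-mono (⊠-≥ G P i c h) ≤₋-refl) (⊠-≥ (G ⊠ P) Q i h h′)) (⊠-≥ P G h′ d j) ⟩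
      (G ⊠ P ⊠ Q) i h′ ⊗ (P ⊠ G) h′ j                     ≤⟨ ⊠-≥ (G ⊠ P ⊠ Q) (P ⊠ G) i h′ j ⟩
      (G ⊠ P ⊠ Q ⊠ (P ⊠ G)) i j                           ∎
      where open import Relation.Binary.Reasoning.PartialOrder ≤₋-poset

    𝓔c-walk-start : ∀ {l i j} → 1 ℕ.≤ l → Walk 𝓔c l i j → i ∈ 𝓝c
    𝓔c-walk-start _ (c ∷ _) = proj₁ (𝓔c-nodes c)

  module _ {γ : ℕ} .{{_ : NonZero γ}} (connected : StronglyConnected (_∈ 𝓝c) 𝓔c)
    (cyclicity : IsCyclicity E γ) (o : Fin n)
    {k : ℕ} (As : Vec (Matrix n) k) (As∈𝒴 : ∀ l → 𝒴 (lookup As l))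
    {T t : ℕ} (transient : IsTransient S γ T) (T≤tγ : T ℕ.≤ t ℕ.* γ)
    {i j : Fin n} {w v : ℝmax} (isW* : Trellis.IsW* As i w) (isV* : Trellis.IsV* As j v) where

    open Trellis As
    open Congruence γ
    open Classes cyclicity o
    open Critical cyclicity o connected

    private
      Γ = prod As
      r = k % γ
      M = (t ℕ.+ 1) ℕ.* γ ∸ r

      r≤ : r ℕ.< (t ℕ.+ 1) ℕ.* γ
      r≤ = ℕ.<-≤-trans (m%n<n k γ) (ℕ.m≤n*m γ (t ℕ.+ 1) {{subst NonZero (ℕ.+-comm 1 t) _}})

      M+r≡ : M ℕ.+ r ≡ (t ℕ.+ 1) ℕ.* γ
      M+r≡ = ℕ.m∸n+n≡m (ℕ.<⇒≤ r≤)

      1≤M : 1 ℕ.≤ M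
      1≤M = ℕ.m<n⇒0<n∸m r≤

      T≤L : T ℕ.≤ M ℕ.+ (r ℕ.+ M)
      T≤L = ℕ.≤-trans T≤tγ (ℕ.≤-trans (ℕ.*-monoˡ-≤ γ (ℕ.m≤m+n t 1)) (ℕ.≤-trans (ℕ.≤-reflexive (sym M+r≡))
        (ℕ.≤-trans (ℕ.m≤m+n (M ℕ.+ r) M) (ℕ.≤-reflexive (ℕ.+-assoc M r M)))))

      -- `M + r` is a multiple of `γ`, and so is `k + M`, because `r` is the residue of `k`.
      k+L~0 : k ℕ.+ (M ℕ.+ (r ℕ.+ M)) ~ 0
      k+L~0 = ~-trans (~-reflexive eq) (*γ~0 (k /ℕ γ ℕ.+ (t ℕ.+ 1) ℕ.+ (t ℕ.+ 1)))
        where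
        shuffle : ∀ r m M → r ℕ.+ m ℕ.+ (M ℕ.+ (r ℕ.+ M)) ≡ m ℕ.+ (M ℕ.+ r) ℕ.+ (M ℕ.+ r)
        shuffle = solve-∀
        factor : ∀ a b g → a ℕ.* g ℕ.+ b ℕ.* g ℕ.+ b ℕ.* g ≡ (a ℕ.+ b ℕ.+ b) ℕ.* g
        factor = solve-∀
        eq : k ℕ.+ (M ℕ.+ (r ℕ.+ M)) ≡ (k /ℕ γ ℕ.+ (t ℕ.+ 1) ℕ.+ (t ℕ.+ 1)) ℕ.* γ
        eq = trans (cong (ℕ._+ (M ℕ.+ (r ℕ.+ M))) (m≡m%n+[m/n]*n k γ))
          (trans (shuffle r (k /ℕ γ ℕ.* γ) M)
            (trans (cong (λ m → k /ℕ γ ℕ.* γ ℕ.+ m ℕ.+ m) M+r≡) (factor (k /ℕ γ) (t ℕ.+ 1) γ)))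

      -- M + (r + M) is the total exponent of S in C S^r R.
      absorb : ∀ x → x ℕ.+ k ℕ.+ (M ℕ.+ (r ℕ.+ M)) ~ x
      absorb x = ~-trans (~-reflexive (ℕ.+-assoc x k _))
        (~-trans (~-+ (~-reflexive refl) k+L~0) (~-reflexive (ℕ.+-identityʳ x)))

    -- An optimal walk is cut at its first critical node; what follows weighs at most 0.
    Γ≤w : ∀ {j} → j ∈ 𝓝c → Γ i j ≤₋ w
    Γ≤w {j} j∈ with Γ i j in eq
    ... | ⊥₋ = ⊥₋≤ _
    ... | [ x ] with w₀ , weight≡ ← prod-attained As As∈𝒴 eq with first-visit critical-node? w₀
    ...   | inj₁ w₀∉ = contradiction j∈ (All-last w₀ w₀∉)
    ...   | inj₂ ((c , m) , w₁ , w₂ , c∈ , w₁∉ , refl) =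
      ≤₋-trans (≤₋-reflexive (≈₋.trans (≈₋.reflexive (sym weight≡)) (weight-◅◅ ω w₁ w₂)))
        (≤₋-trans (⊗≤ˡ (weight≤0 ω (ω≤0 As As∈𝒴) w₂)) (proj₁ isW* _ (c , m , w₁ , c∈ , w₁∉ , ≈₋.refl)))

    Γ≤v : ∀ {i} → i ∈ 𝓝c → Γ i j ≤₋ v
    Γ≤v {i} i∈ with Γ i j in eq
    ... | ⊥₋ = ⊥₋≤ _
    ... | [ x ] with w₀ , weight≡ ← prod-attained As As∈𝒴 eq with last-visit critical-node? w₀
    ...   | inj₁ (i∉ ∷ _) = contradiction i∈ i∉
    ...   | inj₂ ((c , m) , w₁ , w₂ , c∈ , w₂∉ , refl) =
      ≤₋-trans (≤₋-reflexive (≈₋.trans (≈₋.reflexive (sym weight≡)) (weight-◅◅ ω w₁ w₂)))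
        (≤₋-trans (⊗≤ʳ (weight≤0 ω (ω≤0 As As∈𝒴) w₁)) (proj₁ isV* _ (c , m , w₂ , c∈ , w₂∉ , ≈₋.refl)))

    Γ⊗Γ≤CSR : ∀ {c d} → Walk 𝓔c (M ℕ.+ (r ℕ.+ M)) c d → Γ i c ⊗ Γ d j ≤₋ CSR γ t k Γ i j
    Γ⊗Γ≤CSR walk =
      let h , w₁ , w₂₃ = split M walk
          h′ , w₂ , w₃ = split r w₂₃
      in ⊗≤⊠-sandwich Γ (S ^ᵐ M) (S ^ᵐ r) (0≤S^ w₁) (0≤S^ w₂) (0≤S^ w₃)

    -- A finite entry splits into `Γ i a`, a critical walk from `a` to `b` and `Γ b j`. As `M ≥ 1`,
    -- that walk has an edge, so `a` and `b` are critical and `Γ≤w`, `Γ≤v` apply. Its length cancels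
    -- one of the two summands `k` modulo `γ`.
    CSR-finite : ∀ {x} → CSR γ t k Γ i j ≡ [ x ] → χ j ~ χ i ℕ.+ k × [ x ] ≤₋ w ⊗ v
    CSR-finite eq
      with h , _ , _ , eqˡ , eqʳ , refl ← ⊠-attained (C γ t k Γ ⊠ S ^ᵐ r) (R γ t k Γ) {i} {j} eq
      with h′ , _ , _ , eqᶜ , eqˢ , refl ← ⊠-attained (C γ t k Γ) (S ^ᵐ r) {i} {h} eqˡ
      with a , _ , _ , Γia , eqˢ₁ , refl ← ⊠-attained Γ (S ^ᵐ M) {i} {h′} eqᶜ
      with b , _ , _ , eqˢ₂ , Γbj , refl ← ⊠-attained (S ^ᵐ M) Γ {h} {j} eqʳ
      with w₁ , s₁≤0 ← S^-finite M eqˢ₁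
      with w₂ , s₂≤0 ← S^-finite r eqˢ
      with w₃ , s₃≤0 ← S^-finite M eqˢ₂
      = ~-trans (prod-class As As∈𝒴 Γbj) (~-trans
          (~-+ (~-trans (𝓔c-class (w₁ ++ (w₂ ++ w₃)))
                        (~-+ (prod-class As As∈𝒴 Γia) (~-reflexive refl)))
               (~-reflexive refl))
          (~-+ (absorb (χ i)) (~-reflexive refl)))
      , ⊗-mono (≤₋-trans (⊗≤ˡ [ s₂≤0 ]) (≤₋-trans (⊗≤ˡ [ s₁≤0 ])
                 (subst (_≤₋ w) Γia (Γ≤w (𝓔c-walk-start 1≤M w₁)))))
               (≤₋-trans (⊗≤ʳ [ s₃≤0 ])
                 (subst (_≤₋ v) Γbj (Γ≤v (𝓔c-walk-end (𝓔c-walk-start 1≤M w₁) (w₁ ++ (w₂ ++ w₃))))))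

    module _ {a b} (w≡ : w ≡ [ a ]) (v≡ : v ≡ [ b ]) where

      private
        concat : ∀ {x y z} (w₁ : Star Edge x y) (w₂ : Star Edge y z) → ∀ {c d} →
          weight ω w₁ ≈₋ c → weight ω w₂ ≈₋ d → weight ω (w₁ ◅◅ w₂) ≈₋ c ⊗ d
        concat w₁ w₂ p q = ≈₋.trans (weight-◅◅ ω w₁ w₂) (⊗-cong p q)

      -- An optimal walk is prolonged to level `k` by critical edges; in `v≤Γ` it is preceded by
      -- critical edges from level 0.
      w≤Γ : ∃ λ j → j ∈ 𝓝c × w ≤₋ Γ i j
      w≤Γ with proj₂ isW*
      ... | inj₂ (_ , w≡ε) with () ← trans (sym w≡ε) w≡
      ... | inj₁ (c , m , w₁ , c∈ , _ , weight≈)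
        = let f , m+f≡k = ℕ.m≤n⇒∃[o]m+o≡n (ℕ.≤-pred (toℕ<n m))
              d , cw = outgoing f c∈
              w₂ , weight≈0 = climb As As∈𝒴 cw m (fromℕ k) (trans m+f≡k (sym (toℕ-fromℕ k)))
          in d , 𝓔c-walk-end c∈ cw
        , ≤₋-trans (≤₋-reflexive (≈₋.sym (≈₋.trans (concat w₁ w₂ weight≈ weight≈0) (⊗-identityʳ w))))
            (weight≤prod As (w₁ ◅◅ w₂) refl refl)

      v≤Γ : ∃ λ i → i ∈ 𝓝c × v ≤₋ Γ i j
      v≤Γ with proj₂ isV*
      ... | inj₂ (_ , v≡ε) with () ← trans (sym v≡ε) v≡
      ... | inj₁ (c , m , w₁ , c∈ , _ , weight≈)
        = let d , d∈ , cw = incoming (toℕ m) c∈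
              w₂ , weight≈0 = climb As As∈𝒴 cw Fin.zero m refl
          in d , d∈
        , ≤₋-trans (≤₋-reflexive (≈₋.sym (≈₋.trans (concat w₂ w₁ weight≈0 weight≈) (⊗-identityˡ v))))
            (weight≤prod As (w₂ ◅◅ w₁) refl refl)

      -- The critical ends `c` and `d` of `w≤Γ` and `v≤Γ` lie `k` classes after `i` and `k` classes
      -- before `j`. So `d` is in the class of `i`, and the total exponent of `S`, congruent to
      -- `-k`, fits a critical walk from `c` to `d`.
      u≤CSR : χ j ~ χ i ℕ.+ k → w ⊗ v ≤₋ CSR γ t k Γ i j
      u≤CSR i→j = go w≤Γ v≤Γ
        where
        go : (∃ λ c → c ∈ 𝓝c × w ≤₋ Γ i c) → (∃ λ d → d ∈ 𝓝c × v ≤₋ Γ d j) → w ⊗ v ≤₋ CSR γ t k Γ i j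
        go (c , c∈ , w≤) (d , d∈ , v≤) = ≤₋-trans (⊗-mono w≤ v≤)
          (Γ⊗Γ≤CSR (critical-walk transient {c} {d} (M ℕ.+ (r ℕ.+ M)) c∈ d∈ T≤L c→d))
          where
          c→d : χ d ~ χ c ℕ.+ (M ℕ.+ (r ℕ.+ M))
          c→d = ~-trans
            (~-cancelʳ k (~-trans (~-sym (prod-class As As∈𝒴
              (proj₂ (finite-≤ (subst (_≤₋ Γ d j) v≡ v≤))))) i→j))
            (~-trans (~-sym (absorb (χ i)))
              (~-+ (~-sym (prod-class As As∈𝒴
                (proj₂ (finite-≤ (subst (_≤₋ Γ i c) w≡ w≤))))) (~-reflexive refl)))

-- The entries of `Γ` in terms of u*, using the two bounds on `k`.

module Comparison (ℛ : Reals) {p : Level} {n : ℕ} {𝒳 : Pred (Tropical.Matrix ℛ n) p}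
  (setting : Tropical.Setting ℛ 𝒳) where

  open Tropical ℛ
  open OrderedField ℛ
  open MaxPlus ℛ
  open WeightedDigraph ℛ
  open Setting setting
  open Setup ℛ setting
  open CriticalPowers ℛ setting
  open Noncritical ℛ setting
  open CommutativeMonoidSolver (CommutativeRing.+-commutativeMonoid commutativeRing)
    using (solve; _⊜_) renaming (_⊕_ to _+ₑ_)

  private
    add-bounds : ∀ λ* {L₁ L₂ N s k a b α β} →
      fromNat L₁ ≤ fromNat N + ratio λ* (a - α) → fromNat L₂ ≤ fromNat N + ratio λ* (b - β) →
      ratio λ* (a + b - α - β) + fromNat (2 ℕ.* N ℕ.+ s) ≤ fromNat k → L₁ ℕ.+ L₂ ℕ.+ s ℕ.≤ k
    add-bounds λ* {L₁} {L₂} {N} {s} {k} {a} {b} {α} {β} p₁ p₂ p = fromNat-cancel-≤ (begin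
      fromNat (L₁ ℕ.+ L₂ ℕ.+ s)
        ≈⟨ Eq.trans (fromNat-+ (L₁ ℕ.+ L₂) s) (+-congʳ (fromNat-+ L₁ L₂)) ⟩
      fromNat L₁ + fromNat L₂ + fromNat s
        ≤⟨ +-monoˡ-≤ (fromNat s) (+-mono-≤ p₁ p₂) ⟩
      fromNat N + ratio λ* (a - α) + (fromNat N + ratio λ* (b - β)) + fromNat s
        ≈⟨ solve 4 (λ N x y s → ((N +ₑ x) +ₑ (N +ₑ y)) +ₑ s ⊜ (x +ₑ y) +ₑ ((N +ₑ N) +ₑ s)) Eq.refl
             (fromNat N) (ratio λ* (a - α)) (ratio λ* (b - β)) (fromNat s) ⟩
      ratio λ* (a - α) + ratio λ* (b - β) + (fromNat N + fromNat N + fromNat s)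
        ≈⟨ +-cong (Eq.trans (ratio-+ λ* (a - α) (b - β)) (ratio-cong λ*
             (solve 4 (λ a b α β → (a +ₑ α) +ₑ (b +ₑ β) ⊜ ((a +ₑ b) +ₑ α) +ₑ β) Eq.refl a b (- α) (- β))))
             (Eq.trans (+-congʳ (Eq.sym (fromNat-+ N N))) (Eq.sym (fromNat-+ (N ℕ.+ N) s))) ⟩
      ratio λ* (a + b - α - β) + fromNat (N ℕ.+ N ℕ.+ s)
        -- `2 ℕ.* N` computes to `N ℕ.+ (N ℕ.+ 0)`.
        ≡⟨ cong (λ m → ratio λ* (a + b - α - β) + fromNat (N ℕ.+ m ℕ.+ s)) (sym (ℕ.+-identityʳ N)) ⟩
      ratio λ* (a + b - α - β) + fromNat (2 ℕ.* N ℕ.+ s)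
        ≤⟨ p ⟩
      fromNat k ∎)
      where open import Relation.Binary.Reasoning.PartialOrder (DecTotalOrder.poset decTotalOrder)

    bound-finite : ∀ λ* x N {k} → ([ x ] ⟋ λ*) ⊞ N ≤± Ext.[ fromNat k ] → ratio λ* x + fromNat N ≤ fromNat k
    bound-finite ⊥₋    x N = ExtremaOrder.[≤]-injective _≤_
    bound-finite [ μ ] x N = ExtremaOrder.[≤]-injective _≤_

    -- The premises combine to `(u - g) / λ* + N + 1 ≤ k ≤ N + (x - g) /
    -- λ*`, and multiplication by the negative `λ*` reverses the order. For `λ* = ε` both fractions
    -- are 0 and the summand 1 gives a contradiction; for `u = ε` and `λ*` finite the left side is
    -- infinite.
    compare : ∀ λ* → (∀ {μ} → λ* ≡ [ μ ] → μ ≤ 0# × ¬ μ ≈ 0#) → ∀ {u N k x g} →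
      ((u ⊖ g) ⟋ λ*) ⊞ (N ℕ.+ 1) ≤± Ext.[ fromNat k ] →
      fromNat k ≤ fromNat N + ratio λ* (x - g) → [ x ] ≤₋ u
    compare ⊥₋ _ {u} {N} {k} q p = contradiction
      (fromNat-cancel-≤ {N ℕ.+ 1} {N} (begin
        fromNat (N ℕ.+ 1)      ≈⟨ +-identityˡ _ ⟨
        0# + fromNat (N ℕ.+ 1) ≤⟨ ExtremaOrder.[≤]-injective _≤_ q ⟩
        fromNat k              ≤⟨ p ⟩
        fromNat N + 0#         ≈⟨ +-identityʳ _ ⟩
        fromNat N              ∎))
      (ℕ.<⇒≱ (ℕ.≤-reflexive (ℕ.+-comm 1 N)))
      where open import Relation.Binary.Reasoning.PartialOrder (DecTotalOrder.poset decTotalOrder)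
    compare [ μ ] neg {⊥₋}    {N} {k}         ()
    compare [ μ ] neg {[ y ]} {N} {k} {x} {g} q p = [ +-cancelʳ-≤ (- g) (begin
      x - g             ≈⟨ x/y*y≈x (x - g) μ≉0 ⟨
      (x - g) / μ * μ   ≤⟨ *-antiʳ-≤ μ μ≤0 (+-cancelʳ-≤ (fromNat (N ℕ.+ 1)) (begin
        (y - g) / μ + fromNat (N ℕ.+ 1) ≤⟨ ExtremaOrder.[≤]-injective _≤_ q ⟩
        fromNat k                       ≤⟨ p ⟩
        fromNat N + (x - g) / μ         ≤⟨ +-monoˡ-≤ _ (fromNat-mono-≤ (ℕ.m≤m+n N 1)) ⟩
        fromNat (N ℕ.+ 1) + (x - g) / μ ≈⟨ +-comm _ _ ⟩
        (x - g) / μ + fromNat (N ℕ.+ 1) ∎)) ⟩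
      (y - g) / μ * μ   ≈⟨ x/y*y≈x (y - g) μ≉0 ⟩
      y - g             ∎) ]
      where
      open import Relation.Binary.Reasoning.PartialOrder (DecTotalOrder.poset decTotalOrder)
      μ≤0 = proj₁ (neg refl)
      μ≉0 = proj₂ (neg refl)

  module _ (λ* : ℝmax) (maxMean : IsMaxCycleMean Bˢᵘᵖ λ*)
    {k : ℕ} (As : Vec (Matrix n) k) (As∈𝒴 : ∀ l → 𝒴 (lookup As l))
    {i j : Fin n} {w v : ℝmax} (isW* : Trellis.IsW* As i w) (isV* : Trellis.IsV* As j v) where

    open Trellis As
    open Bounds λ* maxMean

    Γ≤u : ∀ {g} → 1 ℕ.≤ k → IsGamma i j g →
      whenFinite g (λ g → ((w ⊗ v ⊖ g) ⟋ λ*) ⊞ (n ∸ q ℕ.+ 1)) ≤± Ext.[ fromNat k ] →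
      ∀ {x} → prod As i j ≡ [ x ] → [ x ] ≤₋ w ⊗ v
    Γ≤u {g} 1≤k isγ bound {x} eq with w₀ , weight≡ ← prod-attained As As∈𝒴 eq
      with first-visit critical-node? w₀
    ... | inj₁ w₀∉ = avoiding
      (avoiding-walk As As∈𝒴 w₀ 1≤k w₀∉ (≤₋-reflexive (≈₋.reflexive (sym weight≡))) isγ) bound
      where
      avoiding : (∃ λ g′ → g ≡ [ g′ ] × fromNat k ≤ fromNat (n ∸ q) + ratio λ* (x - g′)) →
        whenFinite g (λ g → ((w ⊗ v ⊖ g) ⟋ λ*) ⊞ (n ∸ q ℕ.+ 1)) ≤± Ext.[ fromNat k ] → [ x ] ≤₋ w ⊗ v
      avoiding (g′ , refl , p) g≤ = compare λ* negative {w ⊗ v} {n ∸ q} {k} {x} {g′} g≤ p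
    -- The remainder `w₂` starts at a critical node, so it has a last critical visit; the piece
    -- between the two visits weighs at most 0.
    ... | inj₂ ((c , m) , w₁ , w₂ , c∈ , w₁∉ , refl) with last-visit critical-node? w₂
    ...   | inj₁ (c∉ ∷ _) = contradiction c∈ c∉
    ...   | inj₂ ((d , l) , w₃ , w₄ , d∈ , w₄∉ , refl) = begin
      [ x ]                                             ≡⟨ sym weight≡ ⟩
      weight ω (w₁ ◅◅ w₃ ◅◅ w₄)
        ≈⟨ ≈₋.trans (weight-◅◅ ω w₁ (w₃ ◅◅ w₄)) (⊗-cong ≈₋.refl (weight-◅◅ ω w₃ w₄)) ⟩
      weight ω w₁ ⊗ (weight ω w₃ ⊗ weight ω w₄)
        ≤⟨ ⊗-mono (proj₁ isW* _ (c , m , w₁ , c∈ , w₁∉ , ≈₋.refl))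
             (≤₋-trans (⊗≤ʳ (weight≤0 ω (ω≤0 As As∈𝒴) w₃))
               (proj₁ isV* _ (d , l , w₄ , d∈ , w₄∉ , ≈₋.refl))) ⟩
      w ⊗ v                                             ∎
      where open import Relation.Binary.Reasoning.PartialOrder ≤₋-poset

    module _ {γ : ℕ} .{{_ : NonZero γ}} (connected : StronglyConnected (_∈ 𝓝c) 𝓔c)
      (cyclicity : IsCyclicity E γ) (o : Fin n) {T : ℕ} (transient : IsTransient S γ T) where

      open Congruence γ
      open Classes cyclicity o
      open Critical cyclicity o connected

      -- The two optimal walks leave exactly `e ≥ Sch γ q` levels between their critical ends. The
      -- class condition on `i` and `j` passes to these ends, so a critical walk of length `e`
      -- exists, and `climb` inserts it at weight 0.
      u≤Γ : ∀ {a b α β} → w ≡ [ a ] → v ≡ [ b ] → IsAlpha i [ α ] → IsBeta j [ β ] →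
        ((w ⊗ v ⊖ α ⊖ β) ⟋ λ*) ⊞ (2 ℕ.* (n ∸ q) ℕ.+ Sch γ q) ≤± Ext.[ fromNat k ] →
        χ j ~ χ i ℕ.+ k → w ⊗ v ≤₋ prod As i j
      u≤Γ {a} {b} {α} {β} refl refl isα isβ bound i→j
        with c , m , w₁ , c∈ , weight₁ , len₁ ← w*-walk As As∈𝒴 isW* isα
        with d , l , w₂ , d∈ , weight₂ , len₂ ← v*-walk As As∈𝒴 isV* isβ
        = join (ℕ.m≤n⇒∃[o]m+o≡n (add-bounds λ* {length w₁} {length w₂} {n ∸ q} {Sch γ q} {k} len₁ len₂
            (bound-finite λ* _ (2 ℕ.* (n ∸ q) ℕ.+ Sch γ q) {k} bound)))
        where
        L₁ = length w₁
        L₂ = length w₂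
        join : (∃ λ f → L₁ ℕ.+ L₂ ℕ.+ Sch γ q ℕ.+ f ≡ k) → [ a ] ⊗ [ b ] ≤₋ prod As i j
        join (f , eq) = close
          (climb As As∈𝒴 (critical-walk-Sch transient e c∈ d∈ (ℕ.m≤m+n _ f) c→d) m l m+e≡l)
          where
          e = Sch γ q ℕ.+ f
          shuffle : ∀ a b s f → a ℕ.+ b ℕ.+ s ℕ.+ f ≡ a ℕ.+ (s ℕ.+ f) ℕ.+ b
          shuffle = solve-∀
          L₁+e+L₂≡k : L₁ ℕ.+ e ℕ.+ L₂ ≡ k
          L₁+e+L₂≡k = trans (sym (shuffle L₁ L₂ (Sch γ q) f)) eq
          m+e≡l : toℕ m ℕ.+ e ≡ toℕ l
          m+e≡l = ℕ.+-cancelʳ-≡ L₂ _ _ (trans (cong (λ m → m ℕ.+ e ℕ.+ L₂) (sym (level-length As w₁)))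
            (trans L₁+e+L₂≡k (sym (trans (level-length As w₂) (toℕ-fromℕ k)))))
          assoc : ∀ x a e b → x ℕ.+ (a ℕ.+ e ℕ.+ b) ≡ x ℕ.+ a ℕ.+ e ℕ.+ b
          assoc = solve-∀
          c→d : χ d ~ χ c ℕ.+ e
          c→d = ~-cancelʳ L₂ (~-trans (~-sym (trellis-class As w₂)) (~-trans i→j
            (~-trans (~-reflexive (trans (cong (χ i ℕ.+_) (sym L₁+e+L₂≡k)) (assoc (χ i) L₁ e L₂)))
              (~-+ (~-+ (~-sym (trellis-class As w₁)) (~-reflexive refl)) (~-reflexive refl)))))
          close : (Σ[ w₃ ∈ Star Edge (c , m) (d , l) ] weight ω w₃ ≈₋ [ 0# ]) → [ a ] ⊗ [ b ] ≤₋ prod As i j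
          close (w₃ , weight₃) = begin
            [ a ] ⊗ [ b ]
              ≈⟨ ⊗-cong weight₁ (≈₋.trans (⊗-cong weight₃ weight₂) (⊗-identityˡ [ b ])) ⟨
            weight ω w₁ ⊗ (weight ω w₃ ⊗ weight ω w₂)
              ≈⟨ ≈₋.trans (weight-◅◅ ω w₁ (w₃ ◅◅ w₂)) (⊗-cong ≈₋.refl (weight-◅◅ ω w₃ w₂)) ⟨
            weight ω (w₁ ◅◅ w₃ ◅◅ w₂)
              ≤⟨ weight≤prod As (w₁ ◅◅ w₃ ◅◅ w₂) refl refl ⟩
            prod As i j                                 ∎
            where open import Relation.Binary.Reasoning.PartialOrder ≤₋-poset

theorem5p8 :
  (ℛ : Reals) → let open Tropical ℛ in
  ∀ {p : Level} {n : ℕ} {𝒳 : Pred (Matrix n) p} (setting : Setting 𝒳) →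
  let open Setting setting in
  (γ : ℕ) .{{_ : NonZero γ}} →
  StronglyConnected (_∈ 𝓝c) 𝓔c →
  IsCyclicity 𝓔c γ →
  IsCyclicity E γ →
  (k : ℕ) → 1 ℕ.≤ k →
  (As : Vec (Matrix n) k) → (∀ l → 𝒴 (lookup As l)) →
  (T t : ℕ) → IsTransient S γ T → T ℕ.≤ t ℕ.* γ →
  (w v : Fin n → ℝmax) →
  (∀ i → Trellis.IsW* As i (w i)) →
  (∀ j → Trellis.IsV* As j (v j)) →
  -- The values α and β are finite because D(𝒳) is strongly connected
  -- and contains critical nodes.
  (α β : Fin n → Carrier) →
  (∀ i → IsAlpha i [ α i ]) →
  (∀ j → IsBeta j [ β j ]) →
  (γ° : Fin n → Fin n → ℝmax) → (∀ i j → IsGamma i j (γ° i j)) →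
  (λ* : ℝmax) → IsMaxCycleMean Bˢᵘᵖ λ* →
  let u : Fin n → Fin n → ℝmax
      u i j = w i ⊗ v j
      bound₁ = ⨆ λ i → ⨆ λ j →
        (u i j ⊖ α i ⊖ β j) ⟋ λ* ⊞ (2 ℕ.* (n ∸ q) ℕ.+ Sch γ q)
      bound₂ = ⨆ λ i → ⨆ λ j →
        whenFinite (γ° i j) λ g → (u i j ⊖ g) ⟋ λ* ⊞ (n ∸ q ℕ.+ 1)
  in
  bound₁ ⊔± bound₂ ≤± Ext.[ fromNat k ] →
  prod As ≋ CSR γ t k (prod As)
theorem5p8 ℛ {n = n} setting γ connected _ cyclicity k 1≤k As As∈𝒴 T t transient T≤tγ
           w v isW isV α β isα isβ γ° isγ λ* isλ bound i j = ≤₋-antisym Γ≤CSR CSR≤Γ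
  where
  open Tropical ℛ
  open MaxPlus ℛ
  open Setting setting
  open Expansion ℛ setting
  open Comparison ℛ setting
  open Congruence γ
  -- The row index serves as base point of the cyclic classes.
  open Setup.Classes ℛ setting cyclicity i

  b₁ b₂ : Fin n → Fin n → ℝ̄
  b₁ i j = (w i ⊗ v j ⊖ α i ⊖ β j) ⟋ λ* ⊞ (2 ℕ.* (n ∸ q) ℕ.+ Sch γ q)
  b₂ i j = whenFinite (γ° i j) λ g → (w i ⊗ v j ⊖ g) ⟋ λ* ⊞ (n ∸ q ℕ.+ 1)

  bounds : ⨆ (λ i → ⨆ (b₁ i)) ≤± Ext.[ fromNat k ] × ⨆ (λ i → ⨆ (b₂ i)) ≤± Ext.[ fromNat k ]
  bounds = ⊔±-≤ {⨆ λ i → ⨆ (b₁ i)} {⨆ λ i → ⨆ (b₂ i)} bound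

  bound₁ : b₁ i j ≤± Ext.[ fromNat k ]
  bound₁ = ⨆-≤ (b₁ i) (⨆-≤ (λ i → ⨆ (b₁ i)) (proj₁ bounds) i) j

  bound₂ : b₂ i j ≤± Ext.[ fromNat k ]
  bound₂ = ⨆-≤ (b₂ i) (⨆-≤ (λ i → ⨆ (b₂ i)) (proj₂ bounds) i) j

  Γ≤CSR : prod As i j ≤₋ CSR γ t k (prod As) i j
  Γ≤CSR with prod As i j in eq
  ... | ⊥₋ = ⊥₋≤ _
  ... | [ x ] = go (Γ≤u λ* isλ As As∈𝒴 (isW i) (isV j) 1≤k (isγ i j) bound₂ eq)
    where
    class : χ j ~ χ i ℕ.+ k
    class = prod-class As As∈𝒴 eq
    go : [ x ] ≤₋ w i ⊗ v j → [ x ] ≤₋ CSR γ t k (prod As) i j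
    -- A finite lower bound of `w i ⊗ v j` makes both factors finite, as `u≤CSR` requires.
    go x≤u = let _ , u≡ = finite-≤ x≤u
                 _ , _ , w≡ , v≡ = ⊗-finite {w i} {v j} u≡
             in ≤₋-trans x≤u (u≤CSR connected cyclicity i As As∈𝒴 {t = t}
                  transient T≤tγ (isW i) (isV j) w≡ v≡ class)

  CSR≤Γ : CSR γ t k (prod As) i j ≤₋ prod As i j
  CSR≤Γ with CSR γ t k (prod As) i j in eq
  ... | ⊥₋ = ⊥₋≤ _
  ... | [ x ] = go (CSR-finite connected cyclicity i As As∈𝒴 {t = t} transient T≤tγ (isW i) (isV j) eq)
    where
    go : χ j ~ χ i ℕ.+ k × [ x ] ≤₋ w i ⊗ v j → [ x ] ≤₋ prod As i j
    go (class , x≤u) = let _ , u≡ = finite-≤ x≤u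
                           _ , _ , w≡ , v≡ = ⊗-finite {w i} {v j} u≡
                       in ≤₋-trans x≤u (u≤Γ λ* isλ As As∈𝒴 (isW i) (isV j) connected cyclicity i transient
                            w≡ v≡ (isα i) (isβ j) bound₁ class)
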